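{- Let $n$ be a positive integer. Assume that (the image of) $B_n^{(1,2)}$ is a $\mathbb{C}$-vector space basis of $R_n^{(1,2)}$. Then the Hilbert series of $R_n^{(1,2)}$ is $$\mathrm{Hilb}(R_n^{(1,2)};q;u,v)=\sum_{\pi\in\Pi(n)_{>0}}u^{\deg_\theta(\pi)}\,v^{\deg_\xi(\pi)}\,\mathrm{stair}_q(\pi).$$
   Context: **The ring.** Let $\mathbb{C}[\boldsymbol{x}_n,\boldsymbol\theta_n,\boldsymbol\xi_n]$ be the algebra generated by commuting variables $x_1,\ldots,x_n$ (commuting with all variables) and variables $\theta_1,\ldots,\theta_n,\xi_1,\ldots,\xi_n$ which all anticommute with one another (so square to zero). The symmetric group $\mathfrak{S}_n$ acts diagonally by permuting the indices. $R_n^{(1,2)}$ is the quotient by the ideal generated by all $\mathfrak{S}_n$-invariant elements with zero constant term. It is graded by $x$-degree, $\theta$-degree and $\xi$-degree, and $\mathrm{Hilb}(R_n^{(1,2)};q;u,v)=\sum_{a,b,c}\dim\big((R_n^{(1,2)})_{a,b,c}\big)q^au^bv^c$, where $(R_n^{(1,2)})_{a,b,c}$ is the component of $x$-degree $a$, $\theta$-degree $b$, $\xi$-degree $c$. **Paths and $B_n^{(1,2)}$.** $\Pi(n)_{>0}$ is the set of modified Motzkin paths of length $n$: lattice paths $\pi=(p_1,\ldots,p_n)$ in $\mathbb{Z}^2$ starting at $(0,0)$ whose $i$-th step $p_i$ is one of: an (undecorated) up-step $(1,1)$; a horizontal step $(1,0)$ with decoration $\theta_i$; a horizontal step $(1,0)$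 with decoration $\xi_i$; a down-step $(1,-1)$ with decoration $\theta_i\xi_i$; such that the first step is an up-step and afterwards the path never goes below the line $y=1$. Let $T(\pi)$ (resp. $S(\pi)$) be the set of indices $i$ such that $\theta_i$ (resp. $\xi_i$) occurs in the decoration of $p_i$ (subsets of $\{2,\ldots,n\}$), and $\deg_\theta(\pi)=|T(\pi)|$, $\deg_\xi(\pi)=|S(\pi)|$. For $T,S\subseteq\{2,\ldots,n\}$ define $\alpha(T,S)$ by $\alpha_1(T,S)=0$ and, for $2\le i\le n$, $\alpha_i(T,S)=\alpha_{i-1}(T,S)-1+\chi(i\notin T)+\chi(i\notin S)$, where $\chi(P)=1$ if $P$ is true and $0$ otherwise. $B_n^{(1,2)}$ is the set of monomials $x^\alpha\theta_T\xi_S$ ($\theta_T,\xi_S$ the products in increasing order of indices; signs irrelevant) such that $(T,S)=(T(\pi),S(\pi))$ for some $\pi\in\Pi(n)_{>0}$ and $0\le\alpha_i\le\alpha_i(T,S)$ for all $i$. With $[m]_q=1+q+\cdots+q^{m-1}$, $\mathrm{stair}_q(\pi)=\prod_{i=1}^n[\alpha_i(T(\pi),S(\pi))+1]_q$. -}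

module Defs where

open import Algebra.Bundles using (CommutativeRing; Ring; Semiring; RawSemiring)
import Algebra.Definitions.RawSemiring
open import Algebra.Module.Bundles using (LeftModule)
import Algebra.Properties.Ring
import Algebra.Solver.Ring.NaturalCoefficients.Default as NaturalSolver
open import Data.Bool.Base using (if_then_else_)
open import Data.Fin.Base using (Fin)
open import Data.Fin.Permutation using (Permutation′; _⟨$⟩ʳ_)
open import Data.Fin.Subset using (Subset; Side; inside; outside; ∣_∣)
open import Data.Integer.Base as ℤ using (ℤ; +_; -[1+_]; 0ℤ; 1ℤ; -1ℤ)
import Data.Integer.Properties as ℤₚ
open import Data.List.Base as List using (List; []; _∷_; foldr; concatMap; filter)
open import Data.List.Relation.Unary.All using (All)
open import Data.List.Relation.Unary.Unique.Propositional using (Unique)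
open import Data.Nat.Base as ℕ using (ℕ; zero; suc)
import Data.Nat.ListAction as ℕ
import Data.Nat.Properties as ℕₚ
open import Data.Product.Base using (∃; _×_; _,_; proj₁; proj₂)
open import Data.Rational.Base as ℚ using (ℚ; 0ℚ; 1ℚ; ½)
import Data.Rational.Properties as ℚₚ
open import Data.Rational.Solver using (module +-*-Solver)
open import Data.Sum.Base using (inj₁; inj₂)
open import Data.Vec.Base as Vec using (Vec; []; _∷_; lookup)
import Data.Vec.Relation.Unary.All as VecAll
open import Data.Empty using (⊥)
open import Function.Base using (_∘_; const)
open import Level using (0ℓ)
open import Relation.Binary.PropositionalEquality.Core
  using (_≡_; refl; sym; trans; cong; subst)
open import Relation.Nullary.Decidable using (Dec; yes; no; _×-dec_)
open import Relation.Unary using (Pred; U; _⊆_)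
import Relation.Binary.Reasoning.Setoid as SetoidReasoning

-- ℝ as Cauchy sequences of rationals, two sequences being equal when
-- their difference tends to 0.
module Reals where
  open import Data.Rational.Base using (_+_; _*_; _-_; -_; _<_; _≤_; Positive)

  Cauchy : (ℕ → ℚ) → Set
  Cauchy x = ∀ ε → 0ℚ < ε →
    ∃ λ N → ∀ m n → N ℕ.≤ m → N ℕ.≤ n → ℚ.∣ x m - x n ∣ < ε

  TendsTo0 : (ℕ → ℚ) → Set
  TendsTo0 z = ∀ ε → 0ℚ < ε → ∃ λ N → ∀ n → N ℕ.≤ n → ℚ.∣ z n ∣ < ε

  record Real : Set where
    constructor mkReal
    field
      seq    : ℕ → ℚ
      cauchy : Cauchy seq
  open Real

  infix 4 _≈_
  record _≈_ (x y : Real) : Set where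
    constructor mk≈
    field tends : TendsTo0 (λ n → seq x n - seq y n)
  open _≈_

  private
    half-pos : ∀ {ε} → 0ℚ < ε → 0ℚ < ε * ½
    half-pos {ε} p = subst (_< ε * ½) (ℚₚ.*-zeroˡ ½) (ℚₚ.*-monoˡ-<-pos ½ p)

    halves : ∀ ε → ε * ½ + ε * ½ ≡ ε
    halves ε = trans (sym (ℚₚ.*-distribˡ-+ ε ½ ½)) (ℚₚ.*-identityʳ ε)

    ∣+∣< : ∀ {a b} ε → ℚ.∣ a ∣ < ε * ½ → ℚ.∣ b ∣ < ε * ½ → ℚ.∣ a + b ∣ < ε
    ∣+∣< {a} {b} ε p q = ℚₚ.≤-<-trans (ℚₚ.∣p+q∣≤∣p∣+∣q∣ a b)
      (subst (_ <_) (halves ε) (ℚₚ.+-mono-< p q))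

    inv : ∀ M → .{{Positive M}} → ℚ
    inv M = ℚ.1/_ M {{ℚₚ.pos⇒nonZero M}}

    scaled-pos : ∀ M → .{{_ : Positive M}} → ∀ {ε} → 0ℚ < ε → 0ℚ < inv M * ε
    scaled-pos M {ε} p = subst (_< inv M * ε) (ℚₚ.*-zeroʳ (inv M))
      (ℚₚ.*-monoʳ-<-pos (inv M) {{ℚₚ.1/pos⇒pos M}} p)

    ∣*∣< : ∀ M → .{{_ : Positive M}} → ∀ {b z} ε →
           ℚ.∣ b ∣ ≤ M → ℚ.∣ z ∣ < inv M * ε → ℚ.∣ b * z ∣ < ε
    ∣*∣< M {b} {z} ε p q = begin-strict
      ℚ.∣ b * z ∣          ≡⟨ ℚₚ.∣p*q∣≡∣p∣*∣q∣ b z ⟩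
      ℚ.∣ b ∣ * ℚ.∣ z ∣    ≤⟨ ℚₚ.*-monoʳ-≤-nonNeg ℚ.∣ z ∣ {{ℚₚ.∣-∣-nonNeg z}} p ⟩
      M * ℚ.∣ z ∣          <⟨ ℚₚ.*-monoʳ-<-pos M q ⟩
      M * (inv M * ε)      ≡⟨ sym (ℚₚ.*-assoc M (inv M) ε) ⟩
      M * inv M * ε        ≡⟨ cong (_* ε) (ℚₚ.*-inverseʳ M {{ℚₚ.pos⇒nonZero M}}) ⟩
      1ℚ * ε               ≡⟨ ℚₚ.*-identityˡ ε ⟩
      ε                    ∎
      where open ℚₚ.≤-Reasoning

    partialBound : (ℕ → ℚ) → ℕ → ℚ
    partialBound x zero    = ℚ.∣ x 0 ∣
    partialBound x (suc N) = partialBound x N + ℚ.∣ x (suc N) ∣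

    ≤+∣∣ : ∀ a b → a ≤ a + ℚ.∣ b ∣
    ≤+∣∣ a b = subst (_≤ a + ℚ.∣ b ∣) (ℚₚ.+-identityʳ a) (ℚₚ.+-monoʳ-≤ a (ℚₚ.0≤∣p∣ b))

    partialBound-≥0 : ∀ x N → 0ℚ ≤ partialBound x N
    partialBound-≥0 x zero    = ℚₚ.0≤∣p∣ (x 0)
    partialBound-≥0 x (suc N) = ℚₚ.≤-trans (partialBound-≥0 x N) (≤+∣∣ _ (x (suc N)))

    partialBound-bounds : ∀ x N n → n ℕ.≤ N → ℚ.∣ x n ∣ ≤ partialBound x N
    partialBound-bounds x zero .0 ℕ.z≤n = ℚₚ.≤-refl
    partialBound-bounds x (suc N) n n≤ with ℕₚ.m≤n⇒m<n∨m≡n n≤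
    ... | inj₁ (ℕ.s≤s n≤N) =
      ℚₚ.≤-trans (partialBound-bounds x N n n≤N) (≤+∣∣ _ (x (suc N)))
    ... | inj₂ refl = subst (_≤ partialBound x N + ℚ.∣ x (suc N) ∣) (ℚₚ.+-identityˡ _)
      (ℚₚ.+-monoˡ-≤ ℚ.∣ x (suc N) ∣ (partialBound-≥0 x N))

    bounded : ∀ x → Cauchy x → ∃ λ M → Positive M × (∀ n → ℚ.∣ x n ∣ ≤ M)
    bounded x cx with cx 1ℚ (ℚₚ.positive⁻¹ 1ℚ)
    ... | N , close = M , ℚ.positive M>0 , bnd
      where
      M = 1ℚ + partialBound x N
      M>0 : 0ℚ < M
      M>0 = ℚₚ.+-mono-<-≤ (ℚₚ.positive⁻¹ 1ℚ) (partialBound-≥0 x N)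
      split : ∀ a b → a ≡ (a - b) + b
      split = +-*-Solver.solve 2 (λ a b → a := (a :- b) :+ b) refl
        where open +-*-Solver
      bnd : ∀ n → ℚ.∣ x n ∣ ≤ M
      bnd n with ℕₚ.≤-total n N
      ... | inj₁ n≤N = ℚₚ.≤-trans (partialBound-bounds x N n n≤N)
            (subst (_≤ M) (ℚₚ.+-identityˡ _)
              (ℚₚ.+-monoˡ-≤ (partialBound x N) (ℚₚ.<⇒≤ (ℚₚ.positive⁻¹ 1ℚ))))
      ... | inj₂ N≤n = subst (λ t → ℚ.∣ t ∣ ≤ M) (sym (split (x n) (x N)))
            (ℚₚ.≤-trans (ℚₚ.∣p+q∣≤∣p∣+∣q∣ (x n - x N) (x N))
              (ℚₚ.+-mono-≤ (ℚₚ.<⇒≤ (close n N N≤n ℕₚ.≤-refl))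
                           (partialBound-bounds x N N ℕₚ.≤-refl)))

    null-cong : ∀ {z w} → (∀ n → z n ≡ w n) → TendsTo0 z → TendsTo0 w
    null-cong eq p ε ε>0 with p ε ε>0
    ... | N , h = N , λ n N≤n → subst (λ t → ℚ.∣ t ∣ < ε) (eq n) (h n N≤n)

    null-0 : TendsTo0 (λ _ → 0ℚ)
    null-0 ε ε>0 = 0 , λ _ _ → ε>0

    null-+ : ∀ {z w} → TendsTo0 z → TendsTo0 w → TendsTo0 (λ n → z n + w n)
    null-+ p q ε ε>0 with p (ε * ½) (half-pos ε>0) | q (ε * ½) (half-pos ε>0)
    ... | N , h | N′ , h′ = N ℕ.⊔ N′ , λ n ≤n →
      ∣+∣< ε (h n (ℕₚ.≤-trans (ℕₚ.m≤m⊔n N N′) ≤n))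
             (h′ n (ℕₚ.≤-trans (ℕₚ.m≤n⊔m N N′) ≤n))

    null-neg : ∀ {z} → TendsTo0 z → TendsTo0 (λ n → - z n)
    null-neg {z} p ε ε>0 with p ε ε>0
    ... | N , h = N , λ n ≤n → subst (_< ε) (sym (ℚₚ.∣-p∣≡∣p∣ (z n))) (h n ≤n)

    null-* : ∀ {b z} → Cauchy b → TendsTo0 z → TendsTo0 (λ n → b n * z n)
    null-* {b} cb p ε ε>0 with bounded b cb
    ... | M , M>0 , bnd with p (inv M {{M>0}} * ε) (scaled-pos M {{M>0}} ε>0)
    ... | N , h = N , λ n ≤n → ∣*∣< M {{M>0}} ε (bnd n) (h n ≤n)

    cauchy-+ : ∀ {x y} → Cauchy x → Cauchy y → Cauchy (λ n → x n + y n)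
    cauchy-+ {x} {y} p q ε ε>0 with p (ε * ½) (half-pos ε>0) | q (ε * ½) (half-pos ε>0)
    ... | N , h | N′ , h′ = N ℕ.⊔ N′ , λ m n ≤m ≤n →
      subst (λ t → ℚ.∣ t ∣ < ε) (rearrange (x m) (x n) (y m) (y n))
        (∣+∣< ε (h m n (ℕₚ.≤-trans (ℕₚ.m≤m⊔n N N′) ≤m) (ℕₚ.≤-trans (ℕₚ.m≤m⊔n N N′) ≤n))
                (h′ m n (ℕₚ.≤-trans (ℕₚ.m≤n⊔m N N′) ≤m) (ℕₚ.≤-trans (ℕₚ.m≤n⊔m N N′) ≤n)))
      where
      rearrange : ∀ a a′ b b′ → (a - a′) + (b - b′) ≡ (a + b) - (a′ + b′)
      rearrange = +-*-Solver.solve 4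
        (λ a a′ b b′ → (a :- a′) :+ (b :- b′) := (a :+ b) :- (a′ :+ b′)) refl
        where open +-*-Solver

    cauchy-neg : ∀ {x} → Cauchy x → Cauchy (λ n → - x n)
    cauchy-neg {x} p ε ε>0 with p ε ε>0
    ... | N , h = N , λ m n ≤m ≤n →
      subst (λ t → ℚ.∣ t ∣ < ε) (swap (x m) (x n)) (h n m ≤n ≤m)
      where
      swap : ∀ a b → b - a ≡ (- a) - (- b)
      swap = +-*-Solver.solve 2 (λ a b → b :- a := (:- a) :- (:- b)) refl
        where open +-*-Solver

    cauchy-* : ∀ {x y} → Cauchy x → Cauchy y → Cauchy (λ n → x n * y n)
    cauchy-* {x} {y} p q ε ε>0 with bounded x p | bounded y q
    ... | M , M>0 , bx | M′ , M′>0 , by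
      with p (inv M′ {{M′>0}} * (ε * ½)) (scaled-pos M′ {{M′>0}} (half-pos ε>0))
         | q (inv M {{M>0}} * (ε * ½)) (scaled-pos M {{M>0}} (half-pos ε>0))
    ... | N , h | N′ , h′ = N ℕ.⊔ N′ , λ m n ≤m ≤n →
      subst (λ t → ℚ.∣ t ∣ < ε) (rearrange (x m) (x n) (y m) (y n))
        (∣+∣< ε
          (∣*∣< M {{M>0}} (ε * ½) (bx m)
            (h′ m n (ℕₚ.≤-trans (ℕₚ.m≤n⊔m N N′) ≤m) (ℕₚ.≤-trans (ℕₚ.m≤n⊔m N N′) ≤n)))
          (∣*∣< M′ {{M′>0}} (ε * ½) (by n)
            (h m n (ℕₚ.≤-trans (ℕₚ.m≤m⊔n N N′) ≤m) (ℕₚ.≤-trans (ℕₚ.m≤m⊔n N N′) ≤n))))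
      where
      rearrange : ∀ a a′ b b′ → a * (b - b′) + b′ * (a - a′) ≡ a * b - a′ * b′
      rearrange = +-*-Solver.solve 4
        (λ a a′ b b′ → a :* (b :- b′) :+ b′ :* (a :- a′) := a :* b :- a′ :* b′) refl
        where open +-*-Solver

    cauchy-const : ∀ r → Cauchy (const r)
    cauchy-const r ε ε>0 = 0 , λ _ _ _ _ → subst (_< ε) (cong ℚ.∣_∣ (sym (ℚₚ.+-inverseʳ r))) ε>0

  infixl 6 _+ᴿ_
  infixl 7 _*ᴿ_

  fromℚ : ℚ → Real
  fromℚ r = mkReal (const r) (cauchy-const r)

  _+ᴿ_ _*ᴿ_ : Real → Real → Real
  mkReal x cx +ᴿ mkReal y cy = mkReal (λ n → x n + y n) (cauchy-+ {x} {y} cx cy)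
  mkReal x cx *ᴿ mkReal y cy = mkReal (λ n → x n * y n) (cauchy-* {x} {y} cx cy)

  -ᴿ_ : Real → Real
  -ᴿ mkReal x cx = mkReal (λ n → - x n) (cauchy-neg {x} cx)

  private
    _⊖_ : (ℕ → ℚ) → (ℕ → ℚ) → ℕ → ℚ
    (x ⊖ y) n = x n - y n

    pointwise : ∀ {x y} → (∀ n → seq x n ≡ seq y n) → x ≈ y
    pointwise {x} {y} eq = mk≈ (null-cong
      (λ n → sym (trans (cong (_- seq y n) (eq n)) (ℚₚ.+-inverseʳ (seq y n)))) null-0)

    open +-*-Solver using (_:=_; _:+_; _:*_; _:-_; :-_)

    ≈-sym : ∀ {x y} → x ≈ y → y ≈ x
    ≈-sym {x} {y} (mk≈ p) = mk≈ (null-cong (λ n → eq (seq x n) (seq y n)) (null-neg {seq x ⊖ seq y} p))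
      where
      eq : ∀ a b → - (a - b) ≡ b - a
      eq = +-*-Solver.solve 2 (λ a b → (:- (a :- b)) := b :- a) refl

    ≈-trans : ∀ {x y z} → x ≈ y → y ≈ z → x ≈ z
    ≈-trans {x} {y} {z} (mk≈ p) (mk≈ q) =
      mk≈ (null-cong (λ n → eq (seq x n) (seq y n) (seq z n)) (null-+ {seq x ⊖ seq y} {seq y ⊖ seq z} p q))
      where
      eq : ∀ a b c → (a - b) + (b - c) ≡ a - c
      eq = +-*-Solver.solve 3 (λ a b c → (a :- b) :+ (b :- c) := a :- c) refl

    +-cong : ∀ {x x′ y y′} → x ≈ x′ → y ≈ y′ → x +ᴿ y ≈ x′ +ᴿ y′
    +-cong {x} {x′} {y} {y′} (mk≈ p) (mk≈ q) = mk≈ (null-cong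
      (λ n → eq (seq x n) (seq x′ n) (seq y n) (seq y′ n))
      (null-+ {seq x ⊖ seq x′} {seq y ⊖ seq y′} p q))
      where
      eq : ∀ a a′ b b′ → (a - a′) + (b - b′) ≡ (a + b) - (a′ + b′)
      eq = +-*-Solver.solve 4
        (λ a a′ b b′ → (a :- a′) :+ (b :- b′) := (a :+ b) :- (a′ :+ b′)) refl

    *-cong : ∀ {x x′ y y′} → x ≈ x′ → y ≈ y′ → x *ᴿ y ≈ x′ *ᴿ y′
    *-cong {x} {x′} {y} {y′} (mk≈ p) (mk≈ q) = mk≈ (null-cong
      (λ n → eq (seq x n) (seq x′ n) (seq y n) (seq y′ n))
      (null-+ {λ n → seq x n * (seq y n - seq y′ n)} {λ n → seq y′ n * (seq x n - seq x′ n)}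
        (null-* {seq x} {seq y ⊖ seq y′} (cauchy x) q)
        (null-* {seq y′} {seq x ⊖ seq x′} (cauchy y′) p)))
      where
      eq : ∀ a a′ b b′ → a * (b - b′) + b′ * (a - a′) ≡ a * b - a′ * b′
      eq = +-*-Solver.solve 4
        (λ a a′ b b′ → a :* (b :- b′) :+ b′ :* (a :- a′) := a :* b :- a′ :* b′) refl

    neg-cong : ∀ {x y} → x ≈ y → -ᴿ x ≈ -ᴿ y
    neg-cong {x} {y} (mk≈ p) = mk≈ (null-cong (λ n → eq (seq x n) (seq y n)) (null-neg {seq x ⊖ seq y} p))
      where
      eq : ∀ a b → - (a - b) ≡ (- a) - (- b)
      eq = +-*-Solver.solve 2 (λ a b → (:- (a :- b)) := (:- a) :- (:- b)) refl

  ℝ : CommutativeRing 0ℓ 0ℓ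
  ℝ = record
    { Carrier = Real ; _≈_ = _≈_ ; _+_ = _+ᴿ_ ; _*_ = _*ᴿ_ ; -_ = -ᴿ_
    ; 0# = fromℚ 0ℚ ; 1# = fromℚ 1ℚ
    ; isCommutativeRing = record
      { isRing = record
        { +-isAbelianGroup = record
          { isGroup = record
            { isMonoid = record
              { isSemigroup = record
                { isMagma = record
                  { isEquivalence = record
                    { refl  = pointwise (λ _ → refl)
                    ; sym   = ≈-sym
                    ; trans = ≈-trans }
                  ; ∙-cong = +-cong }
                ; assoc = λ x y z → pointwise (λ n → ℚₚ.+-assoc (seq x n) (seq y n) (seq z n)) }
              ; identity = (λ x → pointwise (λ n → ℚₚ.+-identityˡ (seq x n)))
                         , (λ x → pointwise (λ n → ℚₚ.+-identityʳ (seq x n))) }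
            ; inverse = (λ x → pointwise (λ n → ℚₚ.+-inverseˡ (seq x n)))
                      , (λ x → pointwise (λ n → ℚₚ.+-inverseʳ (seq x n)))
            ; ⁻¹-cong = neg-cong }
          ; comm = λ x y → pointwise (λ n → ℚₚ.+-comm (seq x n) (seq y n)) }
        ; *-cong = *-cong
        ; *-assoc = λ x y z → pointwise (λ n → ℚₚ.*-assoc (seq x n) (seq y n) (seq z n))
        ; *-identity = (λ x → pointwise (λ n → ℚₚ.*-identityˡ (seq x n)))
                     , (λ x → pointwise (λ n → ℚₚ.*-identityʳ (seq x n)))
        ; distrib = (λ x y z → pointwise (λ n → ℚₚ.*-distribˡ-+ (seq x n) (seq y n) (seq z n)))
                  , (λ x y z → pointwise (λ n → ℚₚ.*-distribʳ-+ (seq x n) (seq y n) (seq z n))) }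
      ; *-comm = λ x y → pointwise (λ n → ℚₚ.*-comm (seq x n) (seq y n)) } }

open Reals public using (ℝ)

private
  -- Semiring identities; n is to be replaced by -1.
  module Identities (R : CommutativeRing 0ℓ 0ℓ) where
    open CommutativeRing R using (_≈_; _+_; _*_; commutativeSemiring)
      renaming (refl to ≈-refl)
    open NaturalSolver commutativeSemiring using (solve; _:=_; _:+_; _:*_)

    assoc-re : ∀ n a b c d e f →
      (a * c + n * (b * d)) * e + n * ((a * d + b * c) * f)
        ≈ a * (c * e + n * (d * f)) + n * (b * (c * f + d * e))
    assoc-re = solve 7 (λ n a b c d e f →
      (a :* c :+ n :* (b :* d)) :* e :+ n :* ((a :* d :+ b :* c) :* f) := a :* (c :* e :+ n :* (d :* f)) :+ n :* (b :* (c :* f :+ d :* e))) ≈-refl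

    assoc-im : ∀ n a b c d e f →
      (a * c + n * (b * d)) * f + (a * d + b * c) * e
        ≈ a * (c * f + d * e) + b * (c * e + n * (d * f))
    assoc-im = solve 7 (λ n a b c d e f →
      (a :* c :+ n :* (b :* d)) :* f :+ (a :* d :+ b :* c) :* e := a :* (c :* f :+ d :* e) :+ b :* (c :* e :+ n :* (d :* f))) ≈-refl

    distˡ-re : ∀ n a b c d e f →
      a * (c + e) + n * (b * (d + f)) ≈ (a * c + n * (b * d)) + (a * e + n * (b * f))
    distˡ-re = solve 7 (λ n a b c d e f →
      a :* (c :+ e) :+ n :* (b :* (d :+ f)) := (a :* c :+ n :* (b :* d)) :+ (a :* e :+ n :* (b :* f))) ≈-refl

    distˡ-im : ∀ a b c d e f →
      a * (d + f) + b * (c + e) ≈ (a * d + b * c) + (a * f + b * e)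
    distˡ-im = solve 6 (λ a b c d e f →
      a :* (d :+ f) :+ b :* (c :+ e) := (a :* d :+ b :* c) :+ (a :* f :+ b :* e)) ≈-refl

    distʳ-re : ∀ n a b c d e f →
      (c + e) * a + n * ((d + f) * b) ≈ (c * a + n * (d * b)) + (e * a + n * (f * b))
    distʳ-re = solve 7 (λ n a b c d e f →
      (c :+ e) :* a :+ n :* ((d :+ f) :* b) := (c :* a :+ n :* (d :* b)) :+ (e :* a :+ n :* (f :* b))) ≈-refl

    distʳ-im : ∀ a b c d e f →
      (c + e) * b + (d + f) * a ≈ (c * b + d * a) + (e * b + f * a)
    distʳ-im = solve 6 (λ a b c d e f →
      (c :+ e) :* b :+ (d :+ f) :* a := (c :* b :+ d :* a) :+ (e :* b :+ f :* a)) ≈-refl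

    comm-im : ∀ a b c d → a * d + b * c ≈ c * b + d * a
    comm-im = solve 4 (λ a b c d →
      a :* d :+ b :* c := c :* b :+ d :* a) ≈-refl

-- In R[i] the pair (a , b) stands for a + b i.
module AdjoinI (R : CommutativeRing 0ℓ 0ℓ) where
  open CommutativeRing R hiding (zero; refl; sym; trans)

  private
    open Identities R
    open Algebra.Properties.Ring ring using (-0#≈0#; -1*x≈-x)
    infixr 5 _⟫_
    _⟫_ : ∀ {a b c} → a ≈ b → b ≈ c → a ≈ c
    _⟫_ = CommutativeRing.trans R
    ~_ : ∀ {a b} → a ≈ b → b ≈ a
    ~_ = CommutativeRing.sym R

    neg : ∀ z → - z ≈ - 1# * z
    neg z = ~ -1*x≈-x z

    minus : ∀ {y} z → y - z ≈ y + - 1# * z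
    minus z = +-congˡ (neg z)

    *-assoc-re : ∀ a b c d e f →
      (a * c - b * d) * e - (a * d + b * c) * f ≈ a * (c * e - d * f) - b * (c * f + d * e)
    *-assoc-re a b c d e f =
        +-cong (*-congʳ (minus _)) (neg _)
      ⟫ assoc-re (- 1#) a b c d e f
      ⟫ (~ (+-cong (*-congˡ (minus _)) (neg _)))

    *-assoc-im : ∀ a b c d e f →
      (a * c - b * d) * f + (a * d + b * c) * e ≈ a * (c * f + d * e) + b * (c * e - d * f)
    *-assoc-im a b c d e f =
        +-congʳ (*-congʳ (minus _))
      ⟫ assoc-im (- 1#) a b c d e f
      ⟫ (~ (+-congˡ (*-congˡ (minus _))))

    distribˡ-re : ∀ a b c d e f →
      a * (c + e) - b * (d + f) ≈ (a * c - b * d) + (a * e - b * f)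
    distribˡ-re a b c d e f =
      minus _ ⟫ distˡ-re (- 1#) a b c d e f ⟫ (~ (+-cong (minus _) (minus _)))

    distribʳ-re : ∀ a b c d e f →
      (c + e) * a - (d + f) * b ≈ (c * a - d * b) + (e * a - f * b)
    distribʳ-re a b c d e f =
      minus _ ⟫ distʳ-re (- 1#) a b c d e f ⟫ (~ (+-cong (minus _) (minus _)))

    minus-zero : ∀ {a z} → z ≈ 0# → a - z ≈ a
    minus-zero {a} p = +-congˡ (-‿cong p ⟫ -0#≈0#) ⟫ +-identityʳ a

    plus-zero : ∀ {a z} → z ≈ 0# → a + z ≈ a
    plus-zero {a} p = +-congˡ p ⟫ +-identityʳ a

    zero-plus : ∀ {a z} → z ≈ 0# → z + a ≈ a
    zero-plus {a} p = +-congʳ p ⟫ +-identityˡ a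

    identityˡ-re : ∀ a b → 1# * a - 0# * b ≈ a
    identityˡ-re a b = minus-zero (zeroˡ b) ⟫ *-identityˡ a

    identityˡ-im : ∀ a b → 1# * b + 0# * a ≈ b
    identityˡ-im a b = plus-zero (zeroˡ a) ⟫ *-identityˡ b

    identityʳ-re : ∀ a b → a * 1# - b * 0# ≈ a
    identityʳ-re a b = minus-zero (zeroʳ b) ⟫ *-identityʳ a

    identityʳ-im : ∀ a b → a * 0# + b * 1# ≈ b
    identityʳ-im a b = zero-plus (zeroʳ a) ⟫ *-identityʳ b

  R[i] : CommutativeRing 0ℓ 0ℓ
  R[i] = record
    { Carrier = Carrier × Carrier
    ; _≈_ = λ (a , b) (c , d) → (a ≈ c) × (b ≈ d)
    ; _+_ = λ (a , b) (c , d) → (a + c) , (b + d)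
    ; _*_ = λ (a , b) (c , d) → (a * c - b * d) , (a * d + b * c)
    ; -_  = λ (a , b) → (- a) , (- b)
    ; 0# = 0# , 0#
    ; 1# = 1# , 0#
    ; isCommutativeRing = record
      { isRing = record
        { +-isAbelianGroup = record
          { isGroup = record
            { isMonoid = record
              { isSemigroup = record
                { isMagma = record
                  { isEquivalence = record
                    { refl  = reflexive refl , reflexive refl
                    ; sym   = λ (p , q) → CommutativeRing.sym R p , CommutativeRing.sym R q
                    ; trans = λ (p , q) (p′ , q′) →
                        CommutativeRing.trans R p p′ , CommutativeRing.trans R q q′ }
                  ; ∙-cong = λ (p , q) (p′ , q′) → +-cong p p′ , +-cong q q′ }
                ; assoc = λ (a , b) (c , d) (e , f) → +-assoc a c e , +-assoc b d f }
              ; identity = (λ (a , b) → +-identityˡ a , +-identityˡ b)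
                         , (λ (a , b) → +-identityʳ a , +-identityʳ b) }
            ; inverse = (λ (a , b) → -‿inverseˡ a , -‿inverseˡ b)
                      , (λ (a , b) → -‿inverseʳ a , -‿inverseʳ b)
            ; ⁻¹-cong = λ (p , q) → -‿cong p , -‿cong q }
          ; comm = λ (a , b) (c , d) → +-comm a c , +-comm b d }
        ; *-cong = λ (p , q) (p′ , q′) →
            +-cong (*-cong p p′) (-‿cong (*-cong q q′)) , +-cong (*-cong p q′) (*-cong q p′)
        ; *-assoc = λ (a , b) (c , d) (e , f) →
            *-assoc-re a b c d e f , *-assoc-im a b c d e f
        ; *-identity = (λ (a , b) → identityˡ-re a b , identityˡ-im a b)
                     , (λ (a , b) → identityʳ-re a b , identityʳ-im a b)
        ; distrib = (λ (a , b) (c , d) (e , f) → distribˡ-re a b c d e f , distˡ-im a b c d e f)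
                  , (λ (a , b) (c , d) (e , f) → distribʳ-re a b c d e f , distʳ-im a b c d e f) }
      ; *-comm = λ (a , b) (c , d) → +-cong (*-comm a c) (-‿cong (*-comm b d)) , comm-im a b c d } }

ℂ : CommutativeRing 0ℓ 0ℓ
ℂ = AdjoinI.R[i] ℝ

module LinearAlgebra {K : Ring 0ℓ 0ℓ} (M : LeftModule K 0ℓ 0ℓ) where
  open Ring K using (_≈_; 0#) renaming (Carrier to Scalar)
  open LeftModule M using (Carrierᴹ; _≈ᴹ_; _+ᴹ_; _*ₗ_; 0ᴹ)

  lincomb : ∀ {I : Set} → (I → Carrierᴹ) → List (Scalar × I) → Carrierᴹ
  lincomb e = foldr (λ (c , i) m → (c *ₗ e i) +ᴹ m) 0ᴹ

  Span : ∀ {I : Set} → (I → Carrierᴹ) → Pred I 0ℓ → Pred Carrierᴹ 0ℓ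
  Span e P m = ∃ λ cs → All (P ∘ proj₂) cs × (lincomb e cs ≈ᴹ m)

  LinearlyIndependent : ∀ {I : Set} → (I → Carrierᴹ) → Pred I 0ℓ → Set
  LinearlyIndependent e P = ∀ cs → All (P ∘ proj₂) cs → Unique (List.map proj₂ cs) →
    lincomb e cs ≈ᴹ 0ᴹ → All (λ (c , _) → c ≈ 0#) cs

  -- The family of all e i with P i is a basis of the subspace N.
  record IsBasis {I : Set} (N : Pred Carrierᴹ 0ℓ) (e : I → Carrierᴹ) (P : Pred I 0ℓ) : Set where
    field
      members     : ∀ i → P i → N (e i)
      independent : LinearlyIndependent e P
      spanning    : N ⊆ Span e P

  HasDimension : Pred Carrierᴹ 0ℓ → ℕ → Set
  HasDimension N d = ∃ λ (e : Fin d → Carrierᴹ) → IsBasis N e U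

module Quotient (A : Ring 0ℓ 0ℓ) (G : Pred (Ring.Carrier A) 0ℓ) where
  open Ring A hiding (zero; refl; sym; trans)
  open Algebra.Properties.Ring A

  data Ideal : Pred Carrier 0ℓ where
    generator : ∀ {f} → G f → Ideal f
    resp-≈    : ∀ {f g} → f ≈ g → Ideal f → Ideal g
    0∈        : Ideal 0#
    +∈        : ∀ {f g} → Ideal f → Ideal g → Ideal (f + g)
    *ˡ∈       : ∀ h {f} → Ideal f → Ideal (h * f)
    *ʳ∈       : ∀ h {f} → Ideal f → Ideal (f * h)

  infix 4 _~_
  record _~_ (f g : Carrier) : Set where
    constructor mk~
    field difference∈ : Ideal (f - g)

  private
    module E = SetoidReasoning setoid

    neg∈ : ∀ {f} → Ideal f → Ideal (- f)
    neg∈ {f} p = resp-≈ (-1*x≈-x f) (*ˡ∈ (- 1#) p)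

    telescope : ∀ f g h → (f - g) + (g - h) ≈ f - h
    telescope f g h = E.begin
      (f - g) + (g - h)     E.≈⟨ +-assoc f (- g) (g - h) ⟩
      f + (- g + (g - h))   E.≈⟨ +-congˡ (cancelˡ g (- h)) ⟩
      f - h                 E.∎
      where
      cancelˡ : ∀ a b → - a + (a + b) ≈ b
      cancelˡ a b = E.begin
        - a + (a + b)  E.≈⟨ Ring.sym A (+-assoc (- a) a b) ⟩
        (- a + a) + b  E.≈⟨ +-congʳ (-‿inverseˡ a) ⟩
        0# + b         E.≈⟨ +-identityˡ b ⟩
        b              E.∎

    interchange : ∀ a b c d → (a + b) + (c + d) ≈ (a + c) + (b + d)
    interchange a b c d = E.begin
      (a + b) + (c + d)  E.≈⟨ +-assoc a b (c + d) ⟩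
      a + (b + (c + d))  E.≈⟨ +-congˡ (Ring.sym A (+-assoc b c d)) ⟩
      a + ((b + c) + d)  E.≈⟨ +-congˡ (+-congʳ (+-comm b c)) ⟩
      a + ((c + b) + d)  E.≈⟨ +-congˡ (+-assoc c b d) ⟩
      a + (c + (b + d))  E.≈⟨ Ring.sym A (+-assoc a c (b + d)) ⟩
      (a + c) + (b + d)  E.∎

    neg-- : ∀ f g → - (f - g) ≈ g - f
    neg-- f g = E.begin
      - (f - g)      E.≈⟨ Ring.sym A (-‿+-comm f (- g)) ⟩
      - f + - (- g)  E.≈⟨ +-congˡ (-‿involutive g) ⟩
      - f + g        E.≈⟨ +-comm (- f) g ⟩
      g - f          E.∎

  ≈⇒~ : ∀ {f g} → f ≈ g → f ~ g
  ≈⇒~ {f} {g} p =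
    mk~ (resp-≈ (Ring.sym A (Ring.trans A (+-congʳ p) (-‿inverseʳ g))) 0∈)

  private
    ~-sym : ∀ {f g} → f ~ g → g ~ f
    ~-sym {f} {g} (mk~ p) = mk~ (resp-≈ (neg-- f g) (neg∈ p))

    ~-trans : ∀ {f g h} → f ~ g → g ~ h → f ~ h
    ~-trans {f} {g} {h} (mk~ p) (mk~ q) = mk~ (resp-≈ (telescope f g h) (+∈ p q))

    +-~ : ∀ {f f′ g g′} → f ~ f′ → g ~ g′ → f + g ~ f′ + g′
    +-~ {f} {f′} {g} {g′} (mk~ p) (mk~ q) = mk~ (resp-≈
      (Ring.trans A (interchange f (- f′) g (- g′)) (+-congˡ (-‿+-comm f′ g′))) (+∈ p q))

    neg-~ : ∀ {f g} → f ~ g → - f ~ - g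
    neg-~ {f} {g} (mk~ p) = mk~ (resp-≈ (Ring.sym A (-‿+-comm f (- g))) (neg∈ p))

    *-~ : ∀ {f f′ g g′} → f ~ f′ → g ~ g′ → f * g ~ f′ * g′
    *-~ {f} {f′} {g} {g′} (mk~ p) (mk~ q) = mk~ (resp-≈ eq (+∈ (*ʳ∈ g p) (*ˡ∈ f′ q)))
      where
      eq : (f - f′) * g + f′ * (g - g′) ≈ f * g - f′ * g′
      eq = E.begin
        (f - f′) * g + f′ * (g - g′)           E.≈⟨ +-cong ([y-z]x≈yx-zx g f f′) (x[y-z]≈xy-xz f′ g g′) ⟩
        (f * g - f′ * g) + (f′ * g - f′ * g′)  E.≈⟨ telescope (f * g) (f′ * g) (f′ * g′) ⟩
        f * g - f′ * g′                        E.∎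

  quotientRing : Ring 0ℓ 0ℓ
  quotientRing = record
    { Carrier = Carrier ; _≈_ = _~_ ; _+_ = _+_ ; _*_ = _*_ ; -_ = -_ ; 0# = 0# ; 1# = 1#
    ; isRing = record
      { +-isAbelianGroup = record
        { isGroup = record
          { isMonoid = record
            { isSemigroup = record
              { isMagma = record
                { isEquivalence = record
                  { refl = ≈⇒~ (Ring.refl A) ; sym = ~-sym ; trans = ~-trans }
                ; ∙-cong = +-~ }
              ; assoc = λ f g h → ≈⇒~ (+-assoc f g h) }
            ; identity = (λ f → ≈⇒~ (+-identityˡ f)) , (λ f → ≈⇒~ (+-identityʳ f)) }
          ; inverse = (λ f → ≈⇒~ (-‿inverseˡ f)) , (λ f → ≈⇒~ (-‿inverseʳ f))
          ; ⁻¹-cong = neg-~ }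
        ; comm = λ f g → ≈⇒~ (+-comm f g) }
      ; *-cong = *-~
      ; *-assoc = λ f g h → ≈⇒~ (*-assoc f g h)
      ; *-identity = (λ f → ≈⇒~ (*-identityˡ f)) , (λ f → ≈⇒~ (*-identityʳ f))
      ; distrib = (λ f g h → ≈⇒~ (distribˡ f g h)) , (λ f g h → ≈⇒~ (distribʳ f g h)) } }

-- K[x_1,…,x_n,θ_1,…,θ_n,ξ_1,…,ξ_n], given by generators and relations,
-- and its coinvariant quotient. Indices run over Fin n, so that the
-- variable x_i is  x (i - 1).
module Superspace (K : CommutativeRing 0ℓ 0ℓ) (n : ℕ) where
  private module K = CommutativeRing K

  infixl 6 _⊕_
  infixl 7 _⊗_

  data Term : Set where
    con       : K.Carrier → Term
    x θ ξ     : Fin n → Term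
    _⊕_ _⊗_   : Term → Term → Term
    ⊖_        : Term → Term

  infix 4 _≋_

  -- The relations anti-θθ and anti-ξξ at i = j say θ_i² = - θ_i², i.e.
  -- θ_i² = 0 as soon as 2 is invertible in K, e.g. K = ℂ.
  data _≋_ : Term → Term → Set where
    ≋-refl      : ∀ {f} → f ≋ f
    ≋-sym       : ∀ {f g} → f ≋ g → g ≋ f
    ≋-trans     : ∀ {f g h} → f ≋ g → g ≋ h → f ≋ h
    ⊕-cong      : ∀ {f f′ g g′} → f ≋ f′ → g ≋ g′ → f ⊕ g ≋ f′ ⊕ g′
    ⊗-cong      : ∀ {f f′ g g′} → f ≋ f′ → g ≋ g′ → f ⊗ g ≋ f′ ⊗ g′
    ⊖-cong      : ∀ {f g} → f ≋ g → ⊖ f ≋ ⊖ g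

    ⊕-assoc     : ∀ f g h → (f ⊕ g) ⊕ h ≋ f ⊕ (g ⊕ h)
    ⊕-comm      : ∀ f g → f ⊕ g ≋ g ⊕ f
    ⊕-identityˡ : ∀ f → con K.0# ⊕ f ≋ f
    ⊖-inverseˡ  : ∀ f → (⊖ f) ⊕ f ≋ con K.0#
    ⊗-assoc     : ∀ f g h → (f ⊗ g) ⊗ h ≋ f ⊗ (g ⊗ h)
    ⊗-identityˡ : ∀ f → con K.1# ⊗ f ≋ f
    ⊗-identityʳ : ∀ f → f ⊗ con K.1# ≋ f
    distribˡ    : ∀ f g h → f ⊗ (g ⊕ h) ≋ (f ⊗ g) ⊕ (f ⊗ h)
    distribʳ    : ∀ f g h → (g ⊕ h) ⊗ f ≋ (g ⊗ f) ⊕ (h ⊗ f)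

    con-cong    : ∀ {c d} → c K.≈ d → con c ≋ con d
    con-+       : ∀ c d → con (c K.+ d) ≋ con c ⊕ con d
    con-*       : ∀ c d → con (c K.* d) ≋ con c ⊗ con d
    con-central : ∀ c f → con c ⊗ f ≋ f ⊗ con c

    x-central   : ∀ i f → x i ⊗ f ≋ f ⊗ x i
    anti-θθ     : ∀ i j → θ i ⊗ θ j ≋ ⊖ (θ j ⊗ θ i)
    anti-θξ     : ∀ i j → θ i ⊗ ξ j ≋ ⊖ (ξ j ⊗ θ i)
    anti-ξξ     : ∀ i j → ξ i ⊗ ξ j ≋ ⊖ (ξ j ⊗ ξ i)

  superalgebra : Ring 0ℓ 0ℓ
  superalgebra = record
    { Carrier = Term ; _≈_ = _≋_ ; _+_ = _⊕_ ; _*_ = _⊗_ ; -_ = ⊖_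
    ; 0# = con K.0# ; 1# = con K.1#
    ; isRing = record
      { +-isAbelianGroup = record
        { isGroup = record
          { isMonoid = record
            { isSemigroup = record
              { isMagma = record
                { isEquivalence = record { refl = ≋-refl ; sym = ≋-sym ; trans = ≋-trans }
                ; ∙-cong = ⊕-cong }
              ; assoc = ⊕-assoc }
            ; identity = ⊕-identityˡ
                       , (λ f → ≋-trans (⊕-comm f _) (⊕-identityˡ f)) }
          ; inverse = ⊖-inverseˡ , (λ f → ≋-trans (⊕-comm f _) (⊖-inverseˡ f))
          ; ⁻¹-cong = ⊖-cong }
        ; comm = ⊕-comm }
      ; *-cong = ⊗-cong
      ; *-assoc = ⊗-assoc
      ; *-identity = ⊗-identityˡ , ⊗-identityʳ
      ; distrib = distribˡ , distribʳ } }

  act : Permutation′ n → Term → Term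
  act σ (con c) = con c
  act σ (x i)   = x (σ ⟨$⟩ʳ i)
  act σ (θ i)   = θ (σ ⟨$⟩ʳ i)
  act σ (ξ i)   = ξ (σ ⟨$⟩ʳ i)
  act σ (f ⊕ g) = act σ f ⊕ act σ g
  act σ (f ⊗ g) = act σ f ⊗ act σ g
  act σ (⊖ f)   = ⊖ act σ f

  constantTerm : Term → K.Carrier
  constantTerm (con c) = c
  constantTerm (x i)   = K.0#
  constantTerm (θ i)   = K.0#
  constantTerm (ξ i)   = K.0#
  constantTerm (f ⊕ g) = constantTerm f K.+ constantTerm g
  constantTerm (f ⊗ g) = constantTerm f K.* constantTerm g
  constantTerm (⊖ f)   = K.- constantTerm f

  InvariantWithoutConstantTerm : Pred Term 0ℓ
  InvariantWithoutConstantTerm f = (∀ σ → act σ f ≋ f) × (constantTerm f K.≈ K.0#)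

  open Quotient superalgebra InvariantWithoutConstantTerm public

  coinvariants : LeftModule K.ring 0ℓ 0ℓ
  coinvariants = record
    { Carrierᴹ = Term ; _≈ᴹ_ = _~_ ; _+ᴹ_ = _⊕_ ; 0ᴹ = con K.0# ; -ᴹ_ = ⊖_
    ; _*ₗ_ = λ c f → con c ⊗ f
    ; isLeftModule = record
      { isLeftSemimodule = record
        { +ᴹ-isCommutativeMonoid = R.+-isCommutativeMonoid
        ; isPreleftSemimodule = record
          { *ₗ-cong      = λ p q → R.*-cong (≈⇒~ (con-cong p)) q
          ; *ₗ-zeroˡ     = R.zeroˡ
          ; *ₗ-distribʳ  = λ f c d → R.trans (≈⇒~ (⊗-cong (con-+ c d) ≋-refl)) (R.distribʳ f _ _)
          ; *ₗ-identityˡ = R.*-identityˡ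
          ; *ₗ-assoc     = λ c d f → R.trans (≈⇒~ (⊗-cong (con-* c d) ≋-refl)) (R.*-assoc _ _ f)
          ; *ₗ-zeroʳ     = λ c → R.zeroʳ (con c)
          ; *ₗ-distribˡ  = λ c → R.distribˡ (con c) } }
      ; -ᴹ‿cong    = R.-‿cong
      ; -ᴹ‿inverse = R.-‿inverse } }
    where module R = Ring quotientRing

  open LinearAlgebra coinvariants public

  -- The exponent data of x^α θ_T ξ_S.
  record Monomial : Set where
    constructor mono
    field
      α   : Vec ℕ n
      T S : Subset n

  open Algebra.Definitions.RawSemiring (Semiring.rawSemiring (Ring.semiring superalgebra)) using (_^_)

  orderedProduct : (Fin n → Term) → Term
  orderedProduct f = foldr _⊗_ (con K.1#) (List.tabulate f)

  ⟦_⟧ : Monomial → Term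
  ⟦ mono α T S ⟧ =
      orderedProduct (λ i → x i ^ lookup α i)
    ⊗ orderedProduct (λ i → if lookup T i then θ i else con K.1#)
    ⊗ orderedProduct (λ i → if lookup S i then ξ i else con K.1#)

  HasTridegree : ℕ → ℕ → ℕ → Pred Monomial 0ℓ
  HasTridegree a b c (mono α T S) = (Vec.sum α ≡ a) × (∣ T ∣ ≡ b) × (∣ S ∣ ≡ c)

  component : ℕ → ℕ → ℕ → Pred Term 0ℓ
  component a b c = Span ⟦_⟧ (HasTridegree a b c)

data Step : Set where
  up       : Step
  level-θ  : Step
  level-ξ  : Step
  down-θξ  : Step

rise : Step → ℤ
rise up      = 1ℤ
rise level-θ = 0ℤ
rise level-ξ = 0ℤ
rise down-θξ = -1ℤ

hasθ hasξ : Step → Side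
hasθ up      = outside
hasθ level-θ = inside
hasθ level-ξ = outside
hasθ down-θξ = inside

hasξ up      = outside
hasξ level-θ = outside
hasξ level-ξ = inside
hasξ down-θξ = inside

-- The ordinates of the endpoints of the successive steps of a path
-- starting at height y; the abscissae are 1, 2, …, n.
ordinates : ∀ {n} → ℤ → Vec Step n → Vec ℤ n
ordinates y []      = []
ordinates y (s ∷ π) = (y ℤ.+ rise s) ∷ ordinates (y ℤ.+ rise s) π

StartsUp : ∀ {n} → Vec Step n → Set
StartsUp []      = ⊥
StartsUp (s ∷ _) = s ≡ up

InΠ>0 : ∀ {n} → Vec Step n → Set
InΠ>0 π = StartsUp π × VecAll.All (1ℤ ℤ.≤_) (ordinates 0ℤ π)

startsUp? : ∀ {n} (π : Vec Step n) → Dec (StartsUp π)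
startsUp? []            = no λ ()
startsUp? (up ∷ _)      = yes refl
startsUp? (level-θ ∷ _) = no λ ()
startsUp? (level-ξ ∷ _) = no λ ()
startsUp? (down-θξ ∷ _) = no λ ()

inΠ>0? : ∀ {n} (π : Vec Step n) → Dec (InΠ>0 π)
inΠ>0? π = startsUp? π ×-dec VecAll.all? (1ℤ ℤₚ.≤?_) (ordinates 0ℤ π)

stepSequences : ∀ n → List (Vec Step n)
stepSequences zero    = [] ∷ []
stepSequences (suc n) =
  concatMap (λ s → List.map (s ∷_) (stepSequences n)) (up ∷ level-θ ∷ level-ξ ∷ down-θξ ∷ [])

-- Each element of Π(n)_{>0} occurs exactly once.
Π>0 : ∀ n → List (Vec Step n)
Π>0 n = filter inΠ>0? (stepSequences n)

Tset Sset : ∀ {n} → Vec Step n → Subset n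
Tset = Vec.map hasθ
Sset = Vec.map hasξ

degθ degξ : ∀ {n} → Vec Step n → ℕ
degθ π = ∣ Tset π ∣
degξ π = ∣ Sset π ∣

χ∉ : Side → ℤ
χ∉ inside  = 0ℤ
χ∉ outside = 1ℤ

-- The recursion α_i = α_{i-1} - 1 + χ(i ∉ T) + χ(i ∉ S), continued from
-- the preceding value a.
αFrom : ∀ {n} → ℤ → Subset n → Subset n → Vec ℤ n
αFrom a []      []      = []
αFrom a (t ∷ T) (s ∷ S) = a′ ∷ αFrom a′ T S
  where a′ = a ℤ.- 1ℤ ℤ.+ χ∉ t ℤ.+ χ∉ s

-- The sequence α_i(T,S). It is an integer sequence: negative values occur
-- for pairs (T,S) that do not come from a path.
α⟨_,_⟩ : ∀ {n} → Subset n → Subset n → Vec ℤ n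
α⟨ [] , [] ⟩       = []
α⟨ _ ∷ T , _ ∷ S ⟩ = 0ℤ ∷ αFrom 0ℤ T S

module _ (K : CommutativeRing 0ℓ 0ℓ) (n : ℕ) where
  open Superspace K n

  B⁽¹²⁾ : Pred Monomial 0ℓ
  B⁽¹²⁾ (mono α T S) =
      (∃ λ (π : Vec Step n) → InΠ>0 π × (T ≡ Tset π) × (S ≡ Sset π))
    × (∀ i → + lookup α i ℤ.≤ lookup α⟨ T , S ⟩ i)

-- Formal power series in q, u, v with coefficients in ℕ:  f a b c  is the
-- coefficient of q^a u^b v^c.
Series : Set
Series = ℕ → ℕ → ℕ → ℕ

sumUpTo : ℕ → (ℕ → ℕ) → ℕ
sumUpTo m f = ℕ.sum (List.map f (List.upTo (suc m)))

seriesSemiring : RawSemiring 0ℓ 0ℓ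
seriesSemiring = record
  { Carrier = Series
  ; _≈_ = λ f g → ∀ a b c → f a b c ≡ g a b c
  ; _+_ = λ f g a b c → f a b c ℕ.+ g a b c
  ; _*_ = λ f g a b c →
      sumUpTo a λ i → sumUpTo b λ j → sumUpTo c λ k →
        f i j k ℕ.* g (a ℕ.∸ i) (b ℕ.∸ j) (c ℕ.∸ k)
  ; 0# = λ _ _ _ → 0
  ; 1# = λ { 0 0 0 → 1 ; _ _ _ → 0 }
  }

module _ where
  open RawSemiring seriesSemiring using (_+_; _*_; 0#; 1#)
  open Algebra.Definitions.RawSemiring seriesSemiring using (_^_)

  q u v : Series
  q = λ { 1 0 0 → 1 ; _ _ _ → 0 }
  u = λ { 0 1 0 → 1 ; _ _ _ → 0 }
  v = λ { 0 0 1 → 1 ; _ _ _ → 0 }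

  -- [m]_q is only ever used for m ≥ 0; the sum 1 + q + ⋯ + q^(m-1) is
  -- read as empty for negative m.
  [_]q : ℤ → Series
  [ + m ]q      = foldr _+_ 0# (List.map (q ^_) (List.upTo m))
  [ -[1+ _ ] ]q = 0#

  stair : ∀ {n} → Vec Step n → Series
  stair π = Vec.foldr′ _*_ 1# (Vec.map (λ a → [ a ℤ.+ 1ℤ ]q) α⟨ Tset π , Sset π ⟩)

  pathSeries : ℕ → Series
  pathSeries n = foldr _+_ 0# (List.map (λ π → u ^ degθ π * v ^ degξ π * stair π) (Π>0 n))

-- H is the Hilbert series of R_n^(1,2): its q^a u^b v^c coefficient is the
-- dimension of the component of tridegree (a,b,c).
IsHilbertSeries : (K : CommutativeRing 0ℓ 0ℓ) (n : ℕ) → Series → Set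
IsHilbertSeries K n H = ∀ a b c → HasDimension (component a b c) (H a b c)
  where open Superspace K n

{-# OPTIONS --safe #-}
module Submission where

-- The ideal is generated by invariants without constant term, and each
-- homogeneous component of such an invariant is again one, so the ideal is
-- homogeneous for the x-, θ- and ξ-degrees. Hence the projection onto a
-- tridegree descends to the quotient, and applying it to an expansion in the
-- basis B shows that the elements of B of tridegree (a,b,c) are a basis of the
-- component of tridegree (a,b,c). A path is determined by (T,S), so these
-- elements are pairs of a path π and an exponent vector in the box below
-- α(T(π),S(π)), and stair_q(π) is the generating function of that box.

open import Defs
open import Algebra.Bundles using (CommutativeRing; RawSemiring; Ring; Semiring)
import Algebra.Definitions.RawSemiring
open import Algebra.Module.Bundles using (LeftModule)
import Algebra.Properties.CommutativeSemigroup
import Algebra.Properties.Ring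
open import Data.Bool.Base using (if_then_else_)
open import Data.Fin.Base using (Fin; zero; suc)
open import Data.Fin.Subset using (Subset; Side; inside; outside; ∣_∣)
open import Data.Integer.Base as ℤ using (ℤ; +_; -[1+_]; 1ℤ)
open import Data.List.Base as List
  using (List; []; _∷_; _++_; foldr; map; concatMap; filter; length; upTo; cartesianProductWith)
open import Data.List.Membership.Propositional using (_∈_; find; lose)
open import Data.List.Membership.Propositional.Properties
  using (∈-map⁺; ∈-map⁻; ∈-concatMap⁺; ∈-concatMap⁻; ∈-filter⁺; ∈-filter⁻; ∈-upTo⁺; ∈-upTo⁻;
         ∈-cartesianProductWith⁺; ∈-cartesianProductWith⁻; ∈-lookup)
open import Data.List.Properties
  using (filter-accept; filter-all; filter-reject; map-applyUpTo; map-cong; map-upTo; map-∘)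
open import Data.List.Relation.Unary.All as All using (All; []; _∷_)
import Data.List.Relation.Unary.All.Properties as All
import Data.List.Relation.Unary.AllPairs as AllPairs
import Data.List.Relation.Unary.AllPairs.Properties as AllPairs
open import Data.List.Relation.Unary.Any using (here; there; index)
open import Data.List.Relation.Unary.Any.Properties using (lookup-index)
open import Data.List.Relation.Unary.Unique.Propositional using (Unique; []; _∷_)
import Data.List.Relation.Unary.Unique.Propositional.Properties as Unique
open import Data.Nat.Base as ℕ using (ℕ; zero; suc; _∸_; s≤s; NonZero)
import Data.Nat.ListAction as ℕ
import Data.Nat.Properties as ℕₚ
open import Data.Nat.Solver using (module +-*-Solver)
open import Data.Product.Base using (_×_; _,_; proj₁; proj₂; map₂)
open import Data.Vec.Base as Vec using (Vec; []; _∷_; lookup)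
open import Data.Vec.Properties using (∷-injective)
open import Function.Base using (_∘_)
open import Level using (0ℓ)
open import Relation.Binary.PropositionalEquality as ≡ using (_≡_; _≢_; refl; cong; cong₂)
import Relation.Binary.Reasoning.Setoid as SetoidReasoning
open import Relation.Nullary.Decidable using (Dec; yes; no; _×-dec_)
open import Relation.Nullary.Negation using (¬_; contradiction)
open import Relation.Unary using (Pred; U; _∩_)

-- Cauchy products of sequences over a noncommutative ring

module Convolution {c ℓ} (A : Ring c ℓ) where
  open Ring A hiding (zero; refl; sym; trans)
  open Algebra.Properties.Ring A using (-0#≈0#)
  open Algebra.Properties.CommutativeSemigroup +-commutativeSemigroup using (interchange)
  private
    module A = Ring A
    open SetoidReasoning setoid

  infix 4 _≐_
  infixl 7 _∗_

  _≐_ : (f g : ℕ → Carrier) → Set ℓ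
  f ≐ g = ∀ k → f k ≈ g k

  -- The Cauchy product, with the first summand split off recursively instead of indexing by
  -- `k - i`, so that the ring laws follow by induction on `k`. The order of the factors is kept
  -- because `A` need not be commutative.
  _∗_ : (f g : ℕ → Carrier) → ℕ → Carrier
  (f ∗ g) zero    = f 0 * g 0
  (f ∗ g) (suc k) = f 0 * g (suc k) + ((f ∘ suc) ∗ g) k

  -- The monomial a t^d, a sequence being read as a power series in t.
  single : ℕ → Carrier → ℕ → Carrier
  single zero    a zero    = a
  single zero    a (suc k) = 0#
  single (suc d) a zero    = 0#
  single (suc d) a (suc k) = single d a k

  ∗-cong : ∀ {f f′ g g′} → f ≐ f′ → g ≐ g′ → f ∗ g ≐ f′ ∗ g′
  ∗-cong p q zero    = *-cong (p 0) (q 0)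
  ∗-cong p q (suc k) = +-cong (*-cong (p 0) (q (suc k))) (∗-cong (p ∘ suc) q k)

  ∗-distribˡ : ∀ f g h → f ∗ (λ k → g k + h k) ≐ (λ k → (f ∗ g) k + (f ∗ h) k)
  ∗-distribˡ f g h zero    = distribˡ _ _ _
  ∗-distribˡ f g h (suc k) = A.trans
    (+-cong (distribˡ _ _ _) (∗-distribˡ (f ∘ suc) g h k))
    (interchange _ _ _ _)

  ∗-distribʳ : ∀ f g h → (λ k → g k + h k) ∗ f ≐ (λ k → (g ∗ f) k + (h ∗ f) k)
  ∗-distribʳ f g h zero    = distribʳ _ _ _
  ∗-distribʳ f g h (suc k) = A.trans
    (+-cong (distribʳ _ _ _) (∗-distribʳ f (g ∘ suc) (h ∘ suc) k))
    (interchange _ _ _ _)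

  scale-∗ : ∀ a f g → (λ k → a * f k) ∗ g ≐ (λ k → a * (f ∗ g) k)
  scale-∗ a f g zero    = *-assoc _ _ _
  scale-∗ a f g (suc k) = A.trans
    (+-cong (*-assoc _ _ _) (scale-∗ a (f ∘ suc) g k))
    (A.sym (distribˡ _ _ _))

  -- Shifting `f ∗ g` by one gives `f 0` times the shift of `g`, plus the shift of `f` convolved
  -- with `g`. Distributing over these two parts leaves a scalar to pull out and the induction
  -- hypothesis.
  ∗-assoc : ∀ f g h → (f ∗ g) ∗ h ≐ f ∗ (g ∗ h)
  ∗-assoc f g h zero    = *-assoc _ _ _
  ∗-assoc f g h (suc k) = begin
    f 0 * g 0 * h (suc k) + ((λ j → f 0 * g (suc j) + ((f ∘ suc) ∗ g) j) ∗ h) k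
      ≈⟨ +-cong (*-assoc _ _ _) (∗-distribʳ h _ _ k) ⟩
    f 0 * (g 0 * h (suc k)) + (((λ j → f 0 * g (suc j)) ∗ h) k + (((f ∘ suc) ∗ g) ∗ h) k)
      ≈⟨ +-congˡ (+-cong (scale-∗ (f 0) (g ∘ suc) h k) (∗-assoc (f ∘ suc) g h k)) ⟩
    f 0 * (g 0 * h (suc k)) + (f 0 * ((g ∘ suc) ∗ h) k + ((f ∘ suc) ∗ (g ∗ h)) k)
      ≈⟨ +-assoc _ _ _ ⟨
    f 0 * (g 0 * h (suc k)) + f 0 * ((g ∘ suc) ∗ h) k + ((f ∘ suc) ∗ (g ∗ h)) k
      ≈⟨ +-congʳ (distribˡ _ _ _) ⟨
    f 0 * (g ∗ h) (suc k) + ((f ∘ suc) ∗ (g ∗ h)) k ∎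

  ∗-zeroˡ : ∀ f → (λ _ → 0#) ∗ f ≐ (λ _ → 0#)
  ∗-zeroˡ f zero    = zeroˡ _
  ∗-zeroˡ f (suc k) = A.trans (+-cong (zeroˡ _) (∗-zeroˡ f k)) (+-identityˡ 0#)

  single-cong : ∀ d {a b} → a ≈ b → single d a ≐ single d b
  single-cong zero    p zero    = p
  single-cong zero    p (suc k) = A.refl
  single-cong (suc d) p zero    = A.refl
  single-cong (suc d) p (suc k) = single-cong d p k

  single-0 : ∀ d → single d 0# ≐ λ _ → 0#
  single-0 zero    zero    = A.refl
  single-0 zero    (suc k) = A.refl
  single-0 (suc d) zero    = A.refl
  single-0 (suc d) (suc k) = single-0 d k

  single-+ : ∀ d a b → single d (a + b) ≐ λ k → single d a k + single d b k
  single-+ zero    a b zero    = A.refl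
  single-+ zero    a b (suc k) = A.sym (+-identityˡ 0#)
  single-+ (suc d) a b zero    = A.sym (+-identityˡ 0#)
  single-+ (suc d) a b (suc k) = single-+ d a b k

  single-neg : ∀ d a → single d (- a) ≐ λ k → - single d a k
  single-neg zero    a zero    = A.refl
  single-neg zero    a (suc k) = A.sym -0#≈0#
  single-neg (suc d) a zero    = A.sym -0#≈0#
  single-neg (suc d) a (suc k) = single-neg d a k

  scale-single : ∀ a e b k → a * single e b k ≈ single e (a * b) k
  scale-single a zero    b zero    = A.refl
  scale-single a zero    b (suc k) = zeroʳ a
  scale-single a (suc e) b zero    = zeroʳ a
  scale-single a (suc e) b (suc k) = scale-single a e b k

  single₀-∗ : ∀ a f k → (single 0 a ∗ f) k ≈ a * f k
  single₀-∗ a f zero    = A.refl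
  single₀-∗ a f (suc k) = A.trans (+-congˡ (∗-zeroˡ f k)) (+-identityʳ _)

  ∗-single₀ : ∀ f a k → (f ∗ single 0 a) k ≈ f k * a
  ∗-single₀ f a zero    = A.refl
  ∗-single₀ f a (suc k) = A.trans
    (+-cong (zeroʳ _) (∗-single₀ (f ∘ suc) a k)) (+-identityˡ _)

  single-∗-single : ∀ d a e b → single d a ∗ single e b ≐ single (d ℕ.+ e) (a * b)
  single-∗-single zero    a e b k       = A.trans (single₀-∗ a _ k) (scale-single a e b k)
  single-∗-single (suc d) a e b zero    = zeroˡ _
  single-∗-single (suc d) a e b (suc k) = A.trans
    (+-cong (zeroˡ _) (single-∗-single d a e b k)) (+-identityˡ _)

  -- The recursion of `_∗_` shifts the left factor; this is the counterpart for the right one. The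
  -- vanishing of `g 0` removes the last summand.
  ∗-shift : ∀ f g → g 0 ≈ 0# → ∀ k → (f ∗ g) (suc k) ≈ (f ∗ (g ∘ suc)) k
  ∗-shift f g p zero    = A.trans (+-congˡ (A.trans (*-congˡ p) (zeroʳ _))) (+-identityʳ _)
  ∗-shift f g p (suc k) = +-congˡ (∗-shift (f ∘ suc) g p k)

  -- The formal variable commutes with all coefficients, so centrality of `a` passes to `a t^d`.
  -- Each factor `t` is removed by the recursion on the left and by `∗-shift` on the right.
  single-central : ∀ {a} → (∀ b → a * b ≈ b * a) → ∀ d f → single d a ∗ f ≐ f ∗ single d a
  single-central {a} p zero f k = begin
    (single 0 a ∗ f) k  ≈⟨ single₀-∗ a f k ⟩
    a * f k             ≈⟨ p (f k) ⟩
    f k * a             ≈⟨ ∗-single₀ f a k ⟨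
    (f ∗ single 0 a) k  ∎
  single-central p (suc d) f zero    = A.trans (zeroˡ _) (A.sym (zeroʳ _))
  single-central {a} p (suc d) f (suc k) = begin
    0# * f (suc k) + (single d a ∗ f) k  ≈⟨ +-cong (zeroˡ _) (single-central p d f k) ⟩
    0# + (f ∗ single d a) k              ≈⟨ +-identityˡ _ ⟩
    (f ∗ single d a) k                   ≈⟨ ∗-shift f (single (suc d) a) A.refl k ⟨
    (f ∗ single (suc d) a) (suc k)       ∎

  single-diagonal : ∀ d a → single d a d ≡ a
  single-diagonal zero    a = refl
  single-diagonal (suc d) a = single-diagonal d a

  single-off : ∀ {d k} a → d ≢ k → single d a k ≡ 0#
  single-off {zero}  {zero}  a d≢k = contradiction refl d≢k
  single-off {zero}  {suc k} a d≢k = refl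
  single-off {suc d} {zero}  a d≢k = refl
  single-off {suc d} {suc k} a d≢k = single-off a (d≢k ∘ cong suc)

-- Weight gradings of the superalgebra

module Grading (K : CommutativeRing 0ℓ 0ℓ) (n : ℕ) (wx wθ wξ : ℕ) where
  open Superspace K n
  open Algebra.Definitions.RawSemiring (Semiring.rawSemiring (Ring.semiring superalgebra)) using (_^_)
  private
    module K = CommutativeRing K
    module A = Ring superalgebra
    module 𝕂 = Convolution K.ring
    open Convolution superalgebra

  -- components f k is the part of f of weight k, where x i, θ i and ξ i have
  -- weights wx, wθ and wξ.
  components : Term → ℕ → Term
  components (con c) = single 0 (con c)
  components (x i)   = single wx (x i)
  components (θ i)   = single wθ (θ i)
  components (ξ i)   = single wξ (ξ i)
  components (f ⊕ g) = λ k → components f k ⊕ components g k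
  components (f ⊗ g) = components f ∗ components g
  components (⊖ f)   = λ k → ⊖ components f k

  private
    anti : ∀ d a e b → a ⊗ b ≋ ⊖ (b ⊗ a) →
      single d a ∗ single e b ≐ λ k → ⊖ (single e b ∗ single d a) k
    anti d a e b p k = begin
      (single d a ∗ single e b) k       ≈⟨ single-∗-single d a e b k ⟩
      -- The two products sit in weights `d + e` and `e + d`; once these are identified, the
      -- relation `p` can be applied inside a single weight.
      single (d ℕ.+ e) (a ⊗ b) k        ≡⟨ cong (λ j → single j (a ⊗ b) k) (ℕₚ.+-comm d e) ⟩
      single (e ℕ.+ d) (a ⊗ b) k        ≈⟨ single-cong (e ℕ.+ d) p k ⟩
      single (e ℕ.+ d) (⊖ (b ⊗ a)) k    ≈⟨ single-neg (e ℕ.+ d) (b ⊗ a) k ⟩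
      ⊖ single (e ℕ.+ d) (b ⊗ a) k      ≈⟨ ⊖-cong (single-∗-single e b d a k) ⟨
      ⊖ (single e b ∗ single d a) k     ∎
      where open SetoidReasoning A.setoid

  -- Sending `f` to the series of its weight components respects every defining relation: the ring
  -- laws hold for convolution, scalars have weight 0, and the commutation and anticommutation
  -- relations have both sides of the same weight.
  components-cong : ∀ {f g} → f ≋ g → components f ≐ components g
  components-cong ≋-refl            k = ≋-refl
  components-cong (≋-sym p)         k = ≋-sym (components-cong p k)
  components-cong (≋-trans p q)     k = ≋-trans (components-cong p k) (components-cong q k)
  components-cong (⊕-cong p q)      k = ⊕-cong (components-cong p k) (components-cong q k)
  components-cong (⊗-cong p q)      k = ∗-cong (components-cong p) (components-cong q) k
  components-cong (⊖-cong p)        k = ⊖-cong (components-cong p k)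
  components-cong (⊕-assoc f g h)   k = ⊕-assoc _ _ _
  components-cong (⊕-comm f g)      k = ⊕-comm _ _
  components-cong (⊕-identityˡ f)   k = ≋-trans (⊕-cong (single-0 0 k) ≋-refl) (⊕-identityˡ _)
  components-cong (⊖-inverseˡ f)    k = ≋-trans (⊖-inverseˡ _) (≋-sym (single-0 0 k))
  components-cong (⊗-assoc f g h)   k = ∗-assoc (components f) (components g) (components h) k
  components-cong (⊗-identityˡ f)   k = ≋-trans (single₀-∗ _ (components f) k) (⊗-identityˡ _)
  components-cong (⊗-identityʳ f)   k = ≋-trans (∗-single₀ (components f) _ k) (⊗-identityʳ _)
  components-cong (distribˡ f g h)  k = ∗-distribˡ (components f) (components g) (components h) k
  components-cong (distribʳ f g h)  k = ∗-distribʳ (components f) (components g) (components h) k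
  components-cong (con-cong p)      k = single-cong 0 (con-cong p) k
  components-cong (con-+ c d)       k =
    ≋-trans (single-cong 0 (con-+ c d) k) (single-+ 0 (con c) (con d) k)
  components-cong (con-* c d)       k =
    ≋-trans (single-cong 0 (con-* c d) k) (≋-sym (single-∗-single 0 (con c) 0 (con d) k))
  components-cong (con-central c f) k = single-central (con-central c) 0 (components f) k
  components-cong (x-central i f)   k = single-central (x-central i) wx (components f) k
  components-cong (anti-θθ i j)     k = anti wθ _ wθ _ (anti-θθ i j) k
  components-cong (anti-θξ i j)     k = anti wθ _ wξ _ (anti-θξ i j) k
  components-cong (anti-ξξ i j)     k = anti wξ _ wξ _ (anti-ξξ i j) k

  -- Weight components of invariants and of ideal elements

  private
    act-single : ∀ σ d f k → act σ (single d f k) ≡ single d (act σ f) k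
    act-single σ zero    f zero    = refl
    act-single σ zero    f (suc k) = refl
    act-single σ (suc d) f zero    = refl
    act-single σ (suc d) f (suc k) = act-single σ d f k

    act-∗ : ∀ σ {f f′ g g′} → (∀ k → act σ (f k) ≡ f′ k) → (∀ k → act σ (g k) ≡ g′ k) →
            ∀ k → act σ ((f ∗ g) k) ≡ (f′ ∗ g′) k
    act-∗ σ p q zero    = cong₂ _⊗_ (p 0) (q 0)
    act-∗ σ p q (suc k) = cong₂ _⊕_ (cong₂ _⊗_ (p 0) (q (suc k))) (act-∗ σ (p ∘ suc) q k)

  -- The weight of a variable depends only on its kind, not on its index. The equality is even one
  -- of terms, since both operations follow the syntax.
  act-components : ∀ σ f k → act σ (components f k) ≡ components (act σ f) k
  act-components σ (con c) = act-single σ 0 (con c)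
  act-components σ (x i)   = act-single σ wx (x i)
  act-components σ (θ i)   = act-single σ wθ (θ i)
  act-components σ (ξ i)   = act-single σ wξ (ξ i)
  act-components σ (f ⊕ g) k = cong₂ _⊕_ (act-components σ f k) (act-components σ g k)
  act-components σ (f ⊗ g) = act-∗ σ (act-components σ f) (act-components σ g)
  act-components σ (⊖ f)   k = cong ⊖_ (act-components σ f k)

  private
    constantTerm-single : ∀ d f k → constantTerm (single d f k) K.≈ 𝕂.single d (constantTerm f) k
    constantTerm-single zero    f zero    = K.refl
    constantTerm-single zero    f (suc k) = K.refl
    constantTerm-single (suc d) f zero    = K.refl
    constantTerm-single (suc d) f (suc k) = constantTerm-single d f k

    -- A variable may have weight 0, so its position in the sequence does not separate it from the
    -- scalars; its vanishing constant term makes both sides zero in every weight.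
    constantTerm-generator : ∀ d f → constantTerm f K.≈ K.0# →
      ∀ k → constantTerm (single d f k) K.≈ 𝕂.single 0 K.0# k
    constantTerm-generator d f p k = K.trans (constantTerm-single d f k)
      (K.trans (𝕂.single-cong d p k) (K.trans (𝕂.single-0 d k) (K.sym (𝕂.single-0 0 k))))

    constantTerm-∗ : ∀ f g k →
      constantTerm ((f ∗ g) k) K.≈ ((constantTerm ∘ f) 𝕂.∗ (constantTerm ∘ g)) k
    constantTerm-∗ f g zero    = K.refl
    constantTerm-∗ f g (suc k) = K.+-congˡ (constantTerm-∗ (f ∘ suc) g k)

  -- Taking constant terms turns convolution over the superalgebra into convolution over `K`, where
  -- a product of sequences concentrated in weight 0 is again concentrated there.
  constantTerm-components : ∀ f k → constantTerm (components f k) K.≈ 𝕂.single 0 (constantTerm f) k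
  constantTerm-components (con c) = constantTerm-single 0 (con c)
  constantTerm-components (x i)   = constantTerm-generator wx (x i) K.refl
  constantTerm-components (θ i)   = constantTerm-generator wθ (θ i) K.refl
  constantTerm-components (ξ i)   = constantTerm-generator wξ (ξ i) K.refl
  constantTerm-components (f ⊕ g) k = K.trans
    (K.+-cong (constantTerm-components f k) (constantTerm-components g k))
    (K.sym (𝕂.single-+ 0 _ _ k))
  constantTerm-components (f ⊗ g) k = K.trans (constantTerm-∗ (components f) (components g) k)
    (K.trans (𝕂.∗-cong (constantTerm-components f) (constantTerm-components g) k)
      (𝕂.single-∗-single 0 _ 0 _ k))
  constantTerm-components (⊖ f)   k = K.trans
    (K.-‿cong (constantTerm-components f k)) (K.sym (𝕂.single-neg 0 _ k))

  components-generator : ∀ {f} → InvariantWithoutConstantTerm f →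
    ∀ k → InvariantWithoutConstantTerm (components f k)
  components-generator {f} (invariant , vanishes) k =
      (λ σ → ≋-trans (A.reflexive (act-components σ f k)) (components-cong (invariant σ) k))
    , K.trans (constantTerm-components f k)
        (K.trans (𝕂.single-cong 0 vanishes k) (𝕂.single-0 0 k))

  private
    ∗-Idealˡ : ∀ {f g} → (∀ k → Ideal (g k)) → ∀ k → Ideal ((f ∗ g) k)
    ∗-Idealˡ p zero    = *ˡ∈ _ (p 0)
    ∗-Idealˡ p (suc k) = +∈ (*ˡ∈ _ (p (suc k))) (∗-Idealˡ p k)

    ∗-Idealʳ : ∀ {f g} → (∀ k → Ideal (f k)) → ∀ k → Ideal ((f ∗ g) k)
    ∗-Idealʳ p zero    = *ʳ∈ _ (p 0)
    ∗-Idealʳ p (suc k) = +∈ (*ʳ∈ _ (p 0)) (∗-Idealʳ (p ∘ suc) k)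

  -- Homogeneity of the ideal, by induction on how an element is generated. Generators have
  -- generators as components, and each component of a product with an ideal element is a sum of
  -- products that contain a component of that element.
  components-Ideal : ∀ {f} → Ideal f → ∀ k → Ideal (components f k)
  components-Ideal (generator p) k = generator (components-generator p k)
  components-Ideal (resp-≈ p i)  k = resp-≈ (components-cong p k) (components-Ideal i k)
  components-Ideal 0∈            k = resp-≈ (≋-sym (single-0 0 k)) 0∈
  components-Ideal (+∈ i j)      k = +∈ (components-Ideal i k) (components-Ideal j k)
  components-Ideal (*ˡ∈ h i)     k = ∗-Idealˡ (components-Ideal i) k
  components-Ideal (*ʳ∈ h i)     k = ∗-Idealʳ (components-Ideal i) k

  components-~ : ∀ {f g} → f ~ g → ∀ k → components f k ~ components g k
  components-~ (mk~ i) k = mk~ (components-Ideal i k)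

  -- Homogeneity of monomials and components of linear combinations

  record Homogeneous (d : ℕ) (f : Term) : Set where
    constructor homogeneous
    field components≐single : components f ≐ single d f
  open Homogeneous

  ⊗-homogeneous : ∀ {d e f g} → Homogeneous d f → Homogeneous e g → Homogeneous (d ℕ.+ e) (f ⊗ g)
  ⊗-homogeneous {d} {e} {f} {g} (homogeneous p) (homogeneous q) =
    homogeneous λ k → ≋-trans (∗-cong p q k) (single-∗-single d f e g k)

  con-homogeneous : ∀ c → Homogeneous 0 (con c)
  con-homogeneous c = homogeneous λ _ → ≋-refl

  ^-homogeneous : ∀ {d f} → Homogeneous d f → ∀ m → Homogeneous (m ℕ.* d) (f ^ m)
  ^-homogeneous p zero    = con-homogeneous K.1#
  ^-homogeneous p (suc m) = ⊗-homogeneous p (^-homogeneous p m)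

  private
    product-homogeneous : ∀ {m} (f : Fin m → Term) (ds : Vec ℕ m) →
      (∀ i → Homogeneous (lookup ds i) (f i)) →
      Homogeneous (Vec.sum ds) (foldr _⊗_ (con K.1#) (List.tabulate f))
    product-homogeneous f []       p = con-homogeneous K.1#
    product-homogeneous f (d ∷ ds) p =
      ⊗-homogeneous (p zero) (product-homogeneous (f ∘ suc) ds (p ∘ suc))

    weights : ∀ {m} → ℕ → Subset m → Vec ℕ m
    weights w = Vec.map (λ s → if s then w else 0)

    sum-weights : ∀ {m} w (p : Subset m) → Vec.sum (weights w p) ≡ ∣ p ∣ ℕ.* w
    sum-weights w []            = refl
    sum-weights w (inside ∷ p)  = cong (w ℕ.+_) (sum-weights w p)
    sum-weights w (outside ∷ p) = sum-weights w p

    sum-scaled : ∀ {m} w (α : Vec ℕ m) → Vec.sum (Vec.map (ℕ._* w) α) ≡ Vec.sum α ℕ.* w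
    sum-scaled w []      = refl
    sum-scaled w (a ∷ α) = ≡.trans (cong (a ℕ.* w ℕ.+_) (sum-scaled w α))
      (≡.sym (ℕₚ.*-distribʳ-+ w a (Vec.sum α)))

    -- The index map `g` absorbs the shifts by `suc` as the recursion shortens `α`, while the
    -- variables stay indexed by `Fin n`.
    powers-homogeneous : ∀ {m} (α : Vec ℕ m) (g : Fin m → Fin n) i →
      Homogeneous (lookup (Vec.map (ℕ._* wx) α) i) (x (g i) ^ lookup α i)
    powers-homogeneous (a ∷ α) g zero    = ^-homogeneous (homogeneous λ _ → ≋-refl) a
    powers-homogeneous (a ∷ α) g (suc i) = powers-homogeneous α (g ∘ suc) i

    choice-homogeneous : ∀ {m} w (p : Subset m) (f : Fin m → Term) →
      (∀ i → Homogeneous w (f i)) → ∀ i →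
      Homogeneous (lookup (weights w p) i) (if lookup p i then f i else con K.1#)
    choice-homogeneous w (inside ∷ p)  f h zero    = h zero
    choice-homogeneous w (outside ∷ p) f h zero    = con-homogeneous K.1#
    choice-homogeneous w (_ ∷ p)       f h (suc i) = choice-homogeneous w p (f ∘ suc) (h ∘ suc) i

  degree : Monomial → ℕ
  degree (mono α T S) = Vec.sum α ℕ.* wx ℕ.+ ∣ T ∣ ℕ.* wθ ℕ.+ ∣ S ∣ ℕ.* wξ

  ⟦⟧-homogeneous : ∀ m → Homogeneous (degree m) ⟦ m ⟧
  ⟦⟧-homogeneous (mono α T S) = ≡.subst (λ d → Homogeneous d ⟦ mono α T S ⟧)
    (cong₂ ℕ._+_ (cong₂ ℕ._+_ (sum-scaled wx α) (sum-weights wθ T)) (sum-weights wξ S))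
    (⊗-homogeneous
      (⊗-homogeneous
        (product-homogeneous _ (Vec.map (ℕ._* wx) α) (powers-homogeneous α (λ i → i)))
        (product-homogeneous _ (weights wθ T) (choice-homogeneous wθ T θ (λ _ → homogeneous λ _ → ≋-refl))))
      (product-homogeneous _ (weights wξ S) (choice-homogeneous wξ S ξ (λ _ → homogeneous λ _ → ≋-refl))))

  private
    scaled-components : ∀ c m → components (con c ⊗ ⟦ m ⟧) ≐ single (degree m) (con c ⊗ ⟦ m ⟧)
    scaled-components c m =
      components≐single (⊗-homogeneous (con-homogeneous c) (⟦⟧-homogeneous m))

  degree≟ : ∀ k (cm : K.Carrier × Monomial) → Dec (degree (proj₂ cm) ≡ k)
  degree≟ k (_ , m) = degree m ℕₚ.≟ k

  -- Each summand is homogeneous, so taking a component either keeps it whole or replaces it by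
  -- zero.
  components-lincomb : ∀ k cs →
    components (lincomb ⟦_⟧ cs) k ≋ lincomb ⟦_⟧ (filter (degree≟ k) cs)
  components-lincomb k [] = single-0 0 k
  components-lincomb k ((c , m) ∷ cs) with degree m ℕₚ.≟ k
  ... | yes refl rewrite filter-accept (degree≟ k) {c , m} {cs} refl = ⊕-cong
    (≋-trans (scaled-components c m k)
      (A.reflexive (single-diagonal k _)))
    (components-lincomb k cs)
  ... | no d≢k rewrite filter-reject (degree≟ k) {c , m} {cs} d≢k = ≋-trans
    (⊕-cong
      (≋-trans (scaled-components c m k)
        (A.reflexive (single-off _ d≢k)))
      (components-lincomb k cs))
    (⊕-identityˡ _)

-- Dimension from a repetition-free list of basis indices

module _ {A : Set} where
  lookup-injective : ∀ {xs : List A} → Unique xs →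
    ∀ {i j} → List.lookup xs i ≡ List.lookup xs j → i ≡ j
  lookup-injective (x∉ ∷ u) {zero}  {zero}  eq = refl
  lookup-injective (x∉ ∷ u) {zero}  {suc j} eq = contradiction eq (All.lookup x∉ (∈-lookup j))
  lookup-injective (x∉ ∷ u) {suc i} {zero}  eq = contradiction (≡.sym eq) (All.lookup x∉ (∈-lookup i))
  lookup-injective (x∉ ∷ u) {suc i} {suc j} eq = cong suc (lookup-injective u eq)

module Enumerated {K : Ring 0ℓ 0ℓ} (M : LeftModule K 0ℓ 0ℓ) where
  open LinearAlgebra M
  open LeftModule M using (Carrierᴹ; _≈ᴹ_; _+ᴹ_; _*ₗ_; ≈ᴹ-trans; ≈ᴹ-reflexive;
                                *ₗ-identityˡ; +ᴹ-identityʳ)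
  open Ring K using (1#) renaming (Carrier to Scalar)

  lincomb-reindex : ∀ {I J : Set} (e : I → Carrierᴹ) (f : J → I) (cs : List (Scalar × J)) →
    lincomb e (List.map (map₂ f) cs) ≡ lincomb (e ∘ f) cs
  lincomb-reindex e f []             = refl
  lincomb-reindex e f ((c , j) ∷ cs) = cong ((c *ₗ e (f j)) +ᴹ_) (lincomb-reindex e f cs)

  span-generator : ∀ {I : Set} (e : I → Carrierᴹ) {P : Pred I 0ℓ} {i} → P i → Span e P (e i)
  span-generator e {i = i} p =
    (1# , i) ∷ [] , p ∷ [] , ≈ᴹ-trans (+ᴹ-identityʳ _) (*ₗ-identityˡ _)

  -- The positions in the list serve as the index set `Fin d`. Uniqueness keeps distinct positions
  -- distinct as indices, which transfers independence; completeness transfers spanning.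
  enumerated-dimension : ∀ {I : Set} {N} {e : I → Carrierᴹ} {P : Pred I 0ℓ} (is : List I) →
    Unique is → (∀ {i} → i ∈ is → P i) → (∀ {i} → P i → i ∈ is) →
    IsBasis N e P → HasDimension N (length is)
  enumerated-dimension {I} {N} {e} {P} is unique sound complete basis = e ∘ at , record
    { members     = λ j _ → members (at j) (sound (∈-lookup j))
    ; independent = λ cs _ cs-unique eq → All.map⁻ (independent (List.map (map₂ at) cs)
        (All.map⁺ (All.universal (λ (_ , j) → sound (∈-lookup j)) cs))
        -- Both index lists are the same single map over `cs`, because `at ∘ proj₂` and
        -- `proj₂ ∘ map₂ at` agree by definition.
        (≡.subst Unique (≡.trans (≡.sym (map-∘ cs)) (map-∘ cs))
          (Unique.map⁺ (lookup-injective unique) cs-unique))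
        (≈ᴹ-trans (≈ᴹ-reflexive (lincomb-reindex e at cs)) eq))
    ; spanning    = λ m∈N → let cs , ps , eq = spanning m∈N in
        positions cs ps , All.universal _ _ , ≈ᴹ-trans (≈ᴹ-reflexive (positions-lincomb cs ps)) eq
    }
    where
    open IsBasis basis
    at : Fin (length is) → I
    at = List.lookup is
    -- Completeness supplies a position for each index in `cs`. Repeated indices are harmless, as
    -- `Span` allows them.
    positions : ∀ cs → All (P ∘ proj₂) cs → List (Scalar × Fin (length is))
    positions []             []       = []
    positions ((c , i) ∷ cs) (p ∷ ps) = (c , index (complete p)) ∷ positions cs ps
    positions-lincomb : ∀ cs ps → lincomb (e ∘ at) (positions cs ps) ≡ lincomb e cs
    positions-lincomb []             []       = refl
    positions-lincomb ((c , i) ∷ cs) (p ∷ ps) = cong₂ (λ j m → (c *ₗ e j) +ᴹ m)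
      (≡.sym (lookup-index (complete p))) (positions-lincomb cs ps)

-- Projection onto a tridegree and bases of the components

module Tricomponents (K : CommutativeRing 0ℓ 0ℓ) (n : ℕ) where
  open Superspace K n
  open Enumerated coinvariants
  open LeftModule coinvariants using (≈ᴹ-sym; ≈ᴹ-trans)
  private
    module K = CommutativeRing K
    -- The three unit weight vectors specialise the grading to the x-, θ- and ξ-degree.
    module Gx = Grading K n 1 0 0
    module Gθ = Grading K n 0 1 0
    module Gξ = Grading K n 0 0 1
    open +-*-Solver using (solve; _:=_; _:+_; _:*_) renaming (con to const)

  private
    degree-x : ∀ m → Gx.degree m ≡ Vec.sum (Monomial.α m)
    degree-x (mono α T S) = solve 3 (λ a b c →
      a :* const 1 :+ b :* const 0 :+ c :* const 0 := a) refl (Vec.sum α) ∣ T ∣ ∣ S ∣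

    degree-θ : ∀ m → Gθ.degree m ≡ ∣ Monomial.T m ∣
    degree-θ (mono α T S) = solve 3 (λ a b c →
      a :* const 0 :+ b :* const 1 :+ c :* const 0 := b) refl (Vec.sum α) ∣ T ∣ ∣ S ∣

    degree-ξ : ∀ m → Gξ.degree m ≡ ∣ Monomial.S m ∣
    degree-ξ (mono α T S) = solve 3 (λ a b c →
      a :* const 0 :+ b :* const 0 :+ c :* const 1 := c) refl (Vec.sum α) ∣ T ∣ ∣ S ∣

  module _ (a b c : ℕ) where
    project : Term → Term
    project f = Gξ.components (Gθ.components (Gx.components f a) b) c

    -- The projection descends to the quotient because the ideal is homogeneous for each of the
    -- three degrees in turn.
    project-~ : ∀ {f g} → f ~ g → project f ~ project g
    project-~ p = Gξ.components-~ (Gθ.components-~ (Gx.components-~ p a) b) c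

    select : List (K.Carrier × Monomial) → List (K.Carrier × Monomial)
    select = filter (Gξ.degree≟ c) ∘ filter (Gθ.degree≟ b) ∘ filter (Gx.degree≟ a)

    project-lincomb : ∀ cs → project (lincomb ⟦_⟧ cs) ≋ lincomb ⟦_⟧ (select cs)
    project-lincomb cs = ≋-trans
      (Gξ.components-cong (≋-trans
        (Gθ.components-cong (Gx.components-lincomb a cs) b)
        (Gθ.components-lincomb b (filter (Gx.degree≟ a) cs))) c)
      (Gξ.components-lincomb c (filter (Gθ.degree≟ b) (filter (Gx.degree≟ a) cs)))

    select-tridegree : ∀ cs → All (HasTridegree a b c ∘ proj₂) (select cs)
    select-tridegree cs = All.map
      (λ { {_ , m} ((p , q) , r) → ≡.trans (≡.sym (degree-x m)) p
                                 , ≡.trans (≡.sym (degree-θ m)) q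
                                 , ≡.trans (≡.sym (degree-ξ m)) r })
      (All.zip (All.filter⁺ (Gξ.degree≟ c) (All.zip
          (All.filter⁺ (Gθ.degree≟ b) (All.all-filter (Gx.degree≟ a) cs)
          , All.all-filter (Gθ.degree≟ b) (filter (Gx.degree≟ a) cs)))
        , All.all-filter (Gξ.degree≟ c) (filter (Gθ.degree≟ b) (filter (Gx.degree≟ a) cs))))

    select-all : ∀ cs → All (HasTridegree a b c ∘ proj₂) cs → select cs ≡ cs
    select-all cs ps
      rewrite filter-all (Gx.degree≟ a) {cs}
                (All.map (λ {(_ , m)} (p , _ , _) → ≡.trans (degree-x m) p) ps)
            | filter-all (Gθ.degree≟ b) {cs}
                (All.map (λ {(_ , m)} (_ , q , _) → ≡.trans (degree-θ m) q) ps)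
            = filter-all (Gξ.degree≟ c) {cs}
                (All.map (λ {(_ , m)} (_ , _ , r) → ≡.trans (degree-ξ m) r) ps)

    -- Independence passes to a subfamily. For spanning, `f` has an expansion `cs` in monomials of
    -- the tridegree and an expansion `ds` in the given basis. These agree in the quotient;
    -- projecting leaves `cs` unchanged and cuts `ds` down to `select ds`.
    component-basis : ∀ {P} → IsBasis U ⟦_⟧ P → IsBasis (component a b c) ⟦_⟧ (P ∩ HasTridegree a b c)
    component-basis {P} basis = record
      { members     = λ m (_ , h) → span-generator ⟦_⟧ {HasTridegree a b c} {m} h
      ; independent = λ cs ps → independent cs (All.map proj₁ ps)
      ; spanning    = λ {f} (cs , hs , cs~f) → let ds , ps , ds~f = spanning {f} _ in
            select ds
          , All.zip (All.filter⁺ (Gξ.degree≟ c) (All.filter⁺ (Gθ.degree≟ b)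
              (All.filter⁺ (Gx.degree≟ a) ps)) , select-tridegree ds)
          , ≈ᴹ-trans (≈⇒~ (≋-sym (project-lincomb ds)))
              (≈ᴹ-trans (project-~ (≈ᴹ-trans ds~f (≈ᴹ-sym cs~f)))
              (≈ᴹ-trans (≈⇒~ (project-lincomb cs))
              (≡.subst (λ es → lincomb ⟦_⟧ es ~ f) (≡.sym (select-all cs hs)) cs~f)))
      }
      where open IsBasis basis

-- Finite sums and the Kronecker delta

module _ {A : Set} where
  Σ-+ : ∀ (f g : A → ℕ) xs →
    ℕ.sum (map (λ x → f x ℕ.+ g x) xs) ≡ ℕ.sum (map f xs) ℕ.+ ℕ.sum (map g xs)
  Σ-+ f g []       = refl
  Σ-+ f g (x ∷ xs) = ≡.trans (cong (f x ℕ.+ g x ℕ.+_) (Σ-+ f g xs))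
    (interchange (f x) (g x) _ _)
    where open Algebra.Properties.CommutativeSemigroup ℕₚ.+-commutativeSemigroup using (interchange)

  Σ-*ˡ : ∀ c (f : A → ℕ) xs → ℕ.sum (map (λ x → c ℕ.* f x) xs) ≡ c ℕ.* ℕ.sum (map f xs)
  Σ-*ˡ c f []       = ≡.sym (ℕₚ.*-zeroʳ c)
  Σ-*ˡ c f (x ∷ xs) = ≡.trans (cong (c ℕ.* f x ℕ.+_) (Σ-*ˡ c f xs))
    (≡.sym (ℕₚ.*-distribˡ-+ c (f x) _))

sumUpTo-cong : ∀ m {f g : ℕ → ℕ} → (∀ k → f k ≡ g k) → sumUpTo m f ≡ sumUpTo m g
sumUpTo-cong m p = cong ℕ.sum (map-cong p (upTo (suc m)))

sumUpTo-+ : ∀ m f g → sumUpTo m (λ k → f k ℕ.+ g k) ≡ sumUpTo m f ℕ.+ sumUpTo m g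
sumUpTo-+ m f g = Σ-+ f g (upTo (suc m))

sumUpTo-*ˡ : ∀ m c f → sumUpTo m (λ k → c ℕ.* f k) ≡ c ℕ.* sumUpTo m f
sumUpTo-*ˡ m c f = Σ-*ˡ c f (upTo (suc m))

sumUpTo-*ʳ : ∀ m c f → sumUpTo m (λ k → f k ℕ.* c) ≡ sumUpTo m f ℕ.* c
sumUpTo-*ʳ m c f = ≡.trans (sumUpTo-cong m λ k → ℕₚ.*-comm (f k) c)
  (≡.trans (sumUpTo-*ˡ m c f) (ℕₚ.*-comm c _))

sumUpTo-0 : ∀ m → sumUpTo m (λ _ → 0) ≡ 0
sumUpTo-0 m = sumUpTo-*ˡ m 0 (λ _ → 0)

sumUpTo-suc : ∀ m f → sumUpTo (suc m) f ≡ f 0 ℕ.+ sumUpTo m (f ∘ suc)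
sumUpTo-suc m f = cong (λ xs → f 0 ℕ.+ ℕ.sum xs)
  (≡.trans (map-applyUpTo suc f (suc m)) (≡.sym (map-upTo (f ∘ suc) (suc m))))

δ : ℕ → ℕ → ℕ
δ zero    zero    = 1
δ zero    (suc _) = 0
δ (suc _) zero    = 0
δ (suc i) (suc j) = δ i j

δ-refl : ∀ i → δ i i ≡ 1
δ-refl zero    = refl
δ-refl (suc i) = δ-refl i

δ-≢ : ∀ {i j} → i ≢ j → δ i j ≡ 0
δ-≢ {zero}  {zero}  i≢j = contradiction refl i≢j
δ-≢ {zero}  {suc _} i≢j = refl
δ-≢ {suc _} {zero}  i≢j = refl
δ-≢ {suc i} {suc j} i≢j = δ-≢ (i≢j ∘ cong suc)

-- With `δ i` read as the coefficient sequence of `t^i`, this is `t^i t^j = t^(i+j)`. For `i = 0`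
-- only the first summand survives; for `suc i` the first summand vanishes and the others form the
-- convolution for `i`.
δ-convolution : ∀ i j m → sumUpTo m (λ k → δ i k ℕ.* δ j (m ∸ k)) ≡ δ (i ℕ.+ j) m
δ-convolution zero j zero = ≡.trans (ℕₚ.+-identityʳ _) (ℕₚ.+-identityʳ _)
δ-convolution zero j (suc m) = begin
  sumUpTo (suc m) (λ k → δ 0 k ℕ.* δ j (suc m ∸ k))
    ≡⟨ sumUpTo-suc m (λ k → δ 0 k ℕ.* δ j (suc m ∸ k)) ⟩
  1 ℕ.* δ j (suc m) ℕ.+ sumUpTo m (λ _ → 0)
    ≡⟨ cong₂ ℕ._+_ (ℕₚ.*-identityˡ _) (sumUpTo-0 m) ⟩
  δ j (suc m) ℕ.+ 0
    ≡⟨ ℕₚ.+-identityʳ _ ⟩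
  δ j (suc m) ∎
  where open ≡.≡-Reasoning
δ-convolution (suc i) j zero    = refl
δ-convolution (suc i) j (suc m) = ≡.trans
  (sumUpTo-suc m (λ k → δ (suc i) k ℕ.* δ j (suc m ∸ k))) (δ-convolution i j m)

-- Arithmetic of power series in three variables

open RawSemiring seriesSemiring using (_≈_; _+_; _*_; 0#; 1#)
open Algebra.Definitions.RawSemiring seriesSemiring using (_^_)

infixr 4 _⟫_
_⟫_ : ∀ {F G H : Series} → F ≈ G → G ≈ H → F ≈ H
(p ⟫ r) a b c = ≡.trans (p a b c) (r a b c)

≈-sym : ∀ {F G : Series} → F ≈ G → G ≈ F
≈-sym p a b c = ≡.sym (p a b c)

+-cong : ∀ {F F′ G G′ : Series} → F ≈ F′ → G ≈ G′ → F + G ≈ F′ + G′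
+-cong p r a b c = cong₂ ℕ._+_ (p a b c) (r a b c)

*-cong : ∀ {F F′ G G′ : Series} → F ≈ F′ → G ≈ G′ → F * G ≈ F′ * G′
*-cong p r a b c = sumUpTo-cong a λ i → sumUpTo-cong b λ j → sumUpTo-cong c λ k →
  cong₂ ℕ._*_ (p i j k) (r (a ∸ i) (b ∸ j) (c ∸ k))

private
  sumUpTo³-+ : ∀ a b c (f g : ℕ → ℕ → ℕ → ℕ) →
    (sumUpTo a λ i → sumUpTo b λ j → sumUpTo c λ k → f i j k ℕ.+ g i j k) ≡
    (sumUpTo a λ i → sumUpTo b λ j → sumUpTo c λ k → f i j k) ℕ.+
    (sumUpTo a λ i → sumUpTo b λ j → sumUpTo c λ k → g i j k)
  sumUpTo³-+ a b c f g = ≡.trans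
    (sumUpTo-cong a λ i → ≡.trans
      (sumUpTo-cong b λ j → sumUpTo-+ c (f i j) (g i j))
      (sumUpTo-+ b (λ j → sumUpTo c (f i j)) (λ j → sumUpTo c (g i j))))
    (sumUpTo-+ a (λ i → sumUpTo b λ j → sumUpTo c (f i j)) (λ i → sumUpTo b λ j → sumUpTo c (g i j)))

  sumUpTo³-0 : ∀ a b c → (sumUpTo a λ i → sumUpTo b λ j → sumUpTo c λ k → 0) ≡ 0
  sumUpTo³-0 a b c = ≡.trans
    (sumUpTo-cong a λ _ → ≡.trans (sumUpTo-cong b λ _ → sumUpTo-0 c) (sumUpTo-0 b))
    (sumUpTo-0 a)

  sumUpTo³-cong : ∀ a b c {f g : ℕ → ℕ → ℕ → ℕ} → (∀ i j k → f i j k ≡ g i j k) →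
    (sumUpTo a λ i → sumUpTo b λ j → sumUpTo c λ k → f i j k) ≡
    (sumUpTo a λ i → sumUpTo b λ j → sumUpTo c λ k → g i j k)
  sumUpTo³-cong a b c p =
    sumUpTo-cong a λ i → sumUpTo-cong b λ j → sumUpTo-cong c λ k → p i j k

  sumUpTo³-product : ∀ a b c f g h →
    (sumUpTo a λ i → sumUpTo b λ j → sumUpTo c λ k → f i ℕ.* (g j ℕ.* h k)) ≡
    sumUpTo a f ℕ.* (sumUpTo b g ℕ.* sumUpTo c h)
  sumUpTo³-product a b c f g h = begin
    (sumUpTo a λ i → sumUpTo b λ j → sumUpTo c λ k → f i ℕ.* (g j ℕ.* h k))
      ≡⟨ sumUpTo-cong a (λ i → sumUpTo-cong b λ j → ≡.trans
           (sumUpTo-*ˡ c (f i) (λ k → g j ℕ.* h k)) (cong (f i ℕ.*_) (sumUpTo-*ˡ c (g j) h))) ⟩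
    (sumUpTo a λ i → sumUpTo b λ j → f i ℕ.* (g j ℕ.* sumUpTo c h))
      ≡⟨ sumUpTo-cong a (λ i → ≡.trans
           (sumUpTo-*ˡ b (f i) (λ j → g j ℕ.* sumUpTo c h))
           (cong (f i ℕ.*_) (sumUpTo-*ʳ b (sumUpTo c h) g))) ⟩
    (sumUpTo a λ i → f i ℕ.* (sumUpTo b g ℕ.* sumUpTo c h))
      ≡⟨ sumUpTo-*ʳ a (sumUpTo b g ℕ.* sumUpTo c h) f ⟩
    sumUpTo a f ℕ.* (sumUpTo b g ℕ.* sumUpTo c h) ∎
    where open ≡.≡-Reasoning

*-distribʳ-+ : ∀ F G H → (G + H) * F ≈ G * F + H * F
*-distribʳ-+ F G H a b c = ≡.trans
  (sumUpTo³-cong a b c λ i j k → ℕₚ.*-distribʳ-+ (F (a ∸ i) (b ∸ j) (c ∸ k)) (G i j k) (H i j k))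
  (sumUpTo³-+ a b c
    (λ i j k → G i j k ℕ.* F (a ∸ i) (b ∸ j) (c ∸ k))
    (λ i j k → H i j k ℕ.* F (a ∸ i) (b ∸ j) (c ∸ k)))

*-distribˡ-+ : ∀ F G H → F * (G + H) ≈ F * G + F * H
*-distribˡ-+ F G H a b c = ≡.trans
  (sumUpTo³-cong a b c λ i j k →
    ℕₚ.*-distribˡ-+ (F i j k) (G (a ∸ i) (b ∸ j) (c ∸ k)) (H (a ∸ i) (b ∸ j) (c ∸ k)))
  (sumUpTo³-+ a b c
    (λ i j k → F i j k ℕ.* G (a ∸ i) (b ∸ j) (c ∸ k))
    (λ i j k → F i j k ℕ.* H (a ∸ i) (b ∸ j) (c ∸ k)))

*-zeroˡ : ∀ F → 0# * F ≈ 0#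
*-zeroˡ F a b c = sumUpTo³-0 a b c

*-zeroʳ : ∀ F → F * 0# ≈ 0#
*-zeroʳ F a b c = ≡.trans (sumUpTo³-cong a b c λ i j k → ℕₚ.*-zeroʳ (F i j k)) (sumUpTo³-0 a b c)

Tridegree : Set
Tridegree = ℕ × ℕ × ℕ

_⊞_ : Tridegree → Tridegree → Tridegree
(i , j , k) ⊞ (i′ , j′ , k′) = (i ℕ.+ i′) , (j ℕ.+ j′) , (k ℕ.+ k′)

-- The monomial `q^i u^j v^k`.
point : Tridegree → Series
point (i , j , k) a b c = δ i a ℕ.* (δ j b ℕ.* δ k c)

-- The coefficients separate by variable, so the triple convolution is a product of three
-- one-variable convolutions of deltas.
point-* : ∀ s t → point s * point t ≈ point (s ⊞ t)
point-* (i , j , k) (i′ , j′ , k′) a b c = begin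
  (point (i , j , k) * point (i′ , j′ , k′)) a b c
    ≡⟨ sumUpTo³-cong a b c (λ l m n → regroup (δ i l) (δ j m) (δ k n) _ _ _) ⟩
  (sumUpTo a λ l → sumUpTo b λ m → sumUpTo c λ n →
    (δ i l ℕ.* δ i′ (a ∸ l)) ℕ.* ((δ j m ℕ.* δ j′ (b ∸ m)) ℕ.* (δ k n ℕ.* δ k′ (c ∸ n))))
    ≡⟨ sumUpTo³-product a b c (λ l → δ i l ℕ.* δ i′ (a ∸ l))
         (λ m → δ j m ℕ.* δ j′ (b ∸ m)) (λ n → δ k n ℕ.* δ k′ (c ∸ n)) ⟩
  _ ≡⟨ cong₂ ℕ._*_ (δ-convolution i i′ a)
         (cong₂ ℕ._*_ (δ-convolution j j′ b) (δ-convolution k k′ c)) ⟩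
  point ((i , j , k) ⊞ (i′ , j′ , k′)) a b c ∎
  where
  open ≡.≡-Reasoning
  open +-*-Solver
  regroup : ∀ p q r p′ q′ r′ →
    (p ℕ.* (q ℕ.* r)) ℕ.* (p′ ℕ.* (q′ ℕ.* r′)) ≡ (p ℕ.* p′) ℕ.* ((q ℕ.* q′) ℕ.* (r ℕ.* r′))
  regroup = solve 6 (λ p q r p′ q′ r′ →
    (p :* (q :* r)) :* (p′ :* (q′ :* r′)) := (p :* p′) :* ((q :* q′) :* (r :* r′))) refl

-- Generating functions of weighted lists

gf : {A : Set} → (A → Tridegree) → List A → Series
gf w xs = foldr _+_ 0# (map (point ∘ w) xs)

module _ {A : Set} (w : A → Tridegree) where
  gf-++ : ∀ xs ys → gf w (xs ++ ys) ≈ gf w xs + gf w ys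
  gf-++ []       ys a b c = refl
  gf-++ (x ∷ xs) ys a b c = ≡.trans
    (cong (point (w x) a b c ℕ.+_) (gf-++ xs ys a b c))
    (≡.sym (ℕₚ.+-assoc (point (w x) a b c) _ _))

  gf-concatMap : ∀ {B : Set} (f : B → List A) xs →
    gf w (concatMap f xs) ≈ foldr _+_ 0# (map (gf w ∘ f) xs)
  gf-concatMap f []       a b c = refl
  gf-concatMap f (x ∷ xs) = gf-++ (f x) (concatMap f xs) ⟫ +-cong (λ _ _ _ → refl) (gf-concatMap f xs)

module _ {A B : Set} (w : A → Tridegree) (w′ : B → Tridegree) where
  point-*-gf : ∀ t (h : B → A) → (∀ y → t ⊞ w′ y ≡ w (h y)) →
    ∀ ys → point t * gf w′ ys ≈ gf w (map h ys)
  point-*-gf t h p []       = *-zeroʳ (point t)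
  point-*-gf t h p (y ∷ ys) =
      *-distribˡ-+ (point t) (point (w′ y)) (gf w′ ys)
    ⟫ +-cong
        (point-* t (w′ y) ⟫ λ a b c → cong (λ s → point s a b c) (p y))
        (point-*-gf t h p ys)

module _ {A B C : Set} (w : A → Tridegree) (w′ : B → Tridegree) (w″ : C → Tridegree) where
  gf-* : ∀ (h : A → B → C) → (∀ x y → w x ⊞ w′ y ≡ w″ (h x y)) →
    ∀ xs ys → gf w xs * gf w′ ys ≈ gf w″ (cartesianProductWith h xs ys)
  gf-* h p []       ys = *-zeroˡ (gf w′ ys)
  gf-* h p (x ∷ xs) ys =
      *-distribʳ-+ (gf w′ ys) (point (w x)) (gf w xs)
    ⟫ +-cong (point-*-gf w″ w′ (w x) (h x) (p x) ys) (gf-* h p xs ys)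
    ⟫ ≈-sym (gf-++ w″ (map (h x) ys) (cartesianProductWith h xs ys))

1≈point : 1# ≈ point (0 , 0 , 0)
1≈point zero    zero    zero    = refl
1≈point zero    zero    (suc c) = refl
1≈point zero    (suc b) c       = refl
1≈point (suc a) b       c       = refl

q≈point : q ≈ point (1 , 0 , 0)
q≈point 0             b       c       = refl
q≈point 1             zero    zero    = refl
q≈point 1             zero    (suc c) = refl
q≈point 1             (suc b) c       = refl
q≈point (suc (suc a)) b       c       = refl

u≈point : u ≈ point (0 , 1 , 0)
u≈point zero    0             c       = refl
u≈point zero    1             zero    = refl
u≈point zero    1             (suc c) = refl
u≈point zero    (suc (suc b)) c       = refl
u≈point (suc a) b             c       = refl

v≈point : v ≈ point (0 , 0 , 1)
v≈point zero    zero    0             = refl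
v≈point zero    zero    1             = refl
v≈point zero    zero    (suc (suc c)) = refl
v≈point zero    (suc b) c             = refl
v≈point (suc a) b       c             = refl

q^≈point : ∀ k → q ^ k ≈ point (k , 0 , 0)
q^≈point zero    = 1≈point
q^≈point (suc k) = *-cong q≈point (q^≈point k) ⟫ point-* (1 , 0 , 0) (k , 0 , 0)

u^≈point : ∀ k → u ^ k ≈ point (0 , k , 0)
u^≈point zero    = 1≈point
u^≈point (suc k) = *-cong u≈point (u^≈point k) ⟫ point-* (0 , 1 , 0) (0 , k , 0)

v^≈point : ∀ k → v ^ k ≈ point (0 , 0 , k)
v^≈point zero    = 1≈point
v^≈point (suc k) = *-cong v≈point (v^≈point k) ⟫ point-* (0 , 0 , 1) (0 , 0 , k)

-- Exponent boxes and the stair polynomial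

range : ℤ → List ℕ
range (+ m)    = upTo (suc m)
range -[1+ _ ] = []

box : ∀ {n} → Vec ℤ n → List (Vec ℕ n)
box []       = [] ∷ []
box (z ∷ zs) = cartesianProductWith _∷_ (range z) (box zs)

[]q≈gf : ∀ z → [ z ℤ.+ 1ℤ ]q ≈ gf (λ k → k , 0 , 0) (range z)
-- The inclusive bound `m` admits `m + 1` exponents; commuting the sum exposes the `suc m` that
-- `range` uses.
[]q≈gf (+ m)          rewrite ℕₚ.+-comm m 1 = powers (upTo (suc m))
  where
  powers : ∀ ks → foldr _+_ 0# (map (q ^_) ks) ≈ gf (λ k → k , 0 , 0) ks
  powers []       a b c = refl
  powers (k ∷ ks) = +-cong (q^≈point k) (powers ks)
-- At bound -1 the quantum integer is the empty sum `[0]_q`; at smaller bounds it is zero by the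
-- convention for negative arguments.
[]q≈gf -[1+ zero ]    a b c = refl
[]q≈gf -[1+ suc k ]   a b c = refl

-- Each quantum integer lists the admissible exponents in one coordinate, and the box is the
-- cartesian product of these lists.
stair≈gf : ∀ {n} (zs : Vec ℤ n) →
  Vec.foldr′ _*_ 1# (Vec.map (λ z → [ z ℤ.+ 1ℤ ]q) zs) ≈ gf (λ α → Vec.sum α , 0 , 0) (box zs)
stair≈gf []       a b c = ≡.trans (1≈point a b c) (≡.sym (ℕₚ.+-identityʳ _))
stair≈gf (z ∷ zs) =
    *-cong ([]q≈gf z) (stair≈gf zs)
  ⟫ gf-* (λ k → k , 0 , 0) (λ α → Vec.sum α , 0 , 0) (λ α → Vec.sum α , 0 , 0) _∷_
      (λ _ _ → refl) (range z) (box zs)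

∈-range⁺ : ∀ {k z} → + k ℤ.≤ z → k ∈ range z
∈-range⁺ (ℤ.+≤+ k≤m) = ∈-upTo⁺ (s≤s k≤m)

∈-range⁻ : ∀ {k} z → k ∈ range z → + k ℤ.≤ z
∈-range⁻ (+ m) k∈ with ∈-upTo⁻ k∈
... | s≤s k≤m = ℤ.+≤+ k≤m

∈-box⁺ : ∀ {n} {α : Vec ℕ n} zs → (∀ i → + lookup α i ℤ.≤ lookup zs i) → α ∈ box zs
∈-box⁺ {α = []}    []       p = here refl
∈-box⁺ {α = _ ∷ _} (z ∷ zs) p =
  ∈-cartesianProductWith⁺ _∷_ (∈-range⁺ (p zero)) (∈-box⁺ zs (p ∘ suc))

∈-box⁻ : ∀ {n} {α : Vec ℕ n} zs → α ∈ box zs → ∀ i → + lookup α i ℤ.≤ lookup zs i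
∈-box⁻ (z ∷ zs) α∈ i with ∈-cartesianProductWith⁻ _∷_ (range z) (box zs) α∈
∈-box⁻ (z ∷ zs) α∈ zero    | _ , _ , k∈ , α∈′ , refl = ∈-range⁻ z k∈
∈-box⁻ (z ∷ zs) α∈ (suc i) | _ , _ , k∈ , α∈′ , refl = ∈-box⁻ zs α∈′ i

range-unique : ∀ z → Unique (range z)
range-unique (+ m)    = Unique.upTo⁺ (suc m)
range-unique -[1+ _ ] = []

box-unique : ∀ {n} (zs : Vec ℤ n) → Unique (box zs)
box-unique []       = All.[] ∷ []
box-unique (z ∷ zs) =
  Unique.cartesianProductWith⁺ _∷_ ∷-injective (range-unique z) (box-unique zs)

-- Repetition-free enumeration of step sequences

concatMap-unique : ∀ {A B : Set} (f : A → List B) → (∀ x → Unique (f x)) →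
  (∀ {x x′ y} → y ∈ f x → y ∈ f x′ → x ≡ x′) → ∀ {xs} → Unique xs → Unique (concatMap f xs)
concatMap-unique f f-unique origin {xs} xs-unique = Unique.concat⁺
  (All.map⁺ (All.universal f-unique xs))
  (AllPairs.map⁺ (AllPairs.map (λ x≢x′ {_} (y∈ , y∈′) → x≢x′ (origin y∈ y∈′)) xs-unique))

steps : List Step
steps = up ∷ level-θ ∷ level-ξ ∷ down-θξ ∷ []

∈-stepSequences : ∀ {n} (π : Vec Step n) → π ∈ stepSequences n
∈-stepSequences []      = here refl
∈-stepSequences (s ∷ π) =
  ∈-concatMap⁺ (λ s → map (s ∷_) (stepSequences _)) {xs = steps}
    (lose (∈-steps s) (∈-map⁺ (s ∷_) (∈-stepSequences π)))
  where
  ∈-steps : ∀ s → s ∈ steps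
  ∈-steps up      = here refl
  ∈-steps level-θ = there (here refl)
  ∈-steps level-ξ = there (there (here refl))
  ∈-steps down-θξ = there (there (there (here refl)))

stepSequences-unique : ∀ n → Unique (stepSequences n)
stepSequences-unique zero    = All.[] ∷ []
stepSequences-unique (suc n) = concatMap-unique (λ s → map (s ∷_) (stepSequences n))
  (λ s → Unique.map⁺ (proj₂ ∘ ∷-injective) (stepSequences-unique n)) same-head steps-unique
  where
  same-head : ∀ {s s′ : Step} {π : Vec Step (suc n)} →
    π ∈ map (s ∷_) (stepSequences n) → π ∈ map (s′ ∷_) (stepSequences n) → s ≡ s′
  same-head π∈ π∈′ with ∈-map⁻ _ π∈ | ∈-map⁻ _ π∈′
  ... | _ , _ , refl | _ , _ , refl = refl
  steps-unique : Unique steps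
  steps-unique =
      ((λ ()) All.∷ (λ ()) All.∷ (λ ()) All.∷ All.[])
    ∷ ((λ ()) All.∷ (λ ()) All.∷ All.[])
    ∷ ((λ ()) All.∷ All.[])
    ∷ All.[]
    ∷ []

stepWith : Side → Side → Step
stepWith outside outside = up
stepWith inside  outside = level-θ
stepWith outside inside  = level-ξ
stepWith inside  inside  = down-θξ

-- The four steps carry the four different pairs of decorations, so a path is recovered from `T` and
-- `S` step by step.
path-decorations : ∀ {n} (π : Vec Step n) → Vec.zipWith stepWith (Tset π) (Sset π) ≡ π
path-decorations []            = refl
path-decorations (up ∷ π)      = cong (up ∷_) (path-decorations π)
path-decorations (level-θ ∷ π) = cong (level-θ ∷_) (path-decorations π)
path-decorations (level-ξ ∷ π) = cong (level-ξ ∷_) (path-decorations π)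
path-decorations (down-θξ ∷ π) = cong (down-θξ ∷_) (path-decorations π)

-- Enumeration of the basis monomials and their generating function

module Enumeration (K : CommutativeRing 0ℓ 0ℓ) (n : ℕ) where
  open Superspace K n using (Monomial; mono; HasTridegree)

  monomials : Vec Step n → List Monomial
  monomials π = map (λ α → mono α (Tset π) (Sset π)) (box α⟨ Tset π , Sset π ⟩)

  basisMonomials : List Monomial
  basisMonomials = concatMap monomials (Π>0 n)

  tridegree : Monomial → Tridegree
  tridegree (mono α T S) = Vec.sum α , ∣ T ∣ , ∣ S ∣

  -- All monomials of one path share their θ- and ξ-degree, so the factor in `u` and `v` is one
  -- monomial that shifts the generating function of the box.
  monomials≈gf : ∀ π → u ^ degθ π * v ^ degξ π * stair π ≈ gf tridegree (monomials π)
  monomials≈gf π =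
      *-cong
        (*-cong (u^≈point t) (v^≈point s)
          ⟫ point-* (0 , t , 0) (0 , 0 , s)
          ⟫ λ a b c → cong (λ d → point (0 , d , s) a b c) (ℕₚ.+-identityʳ t))
        (stair≈gf α⟨ Tset π , Sset π ⟩)
    ⟫ point-*-gf tridegree (λ α → Vec.sum α , 0 , 0) (0 , t , s) _
        (λ α → cong₂ (λ d e → Vec.sum α , d , e) (ℕₚ.+-identityʳ t) (ℕₚ.+-identityʳ s))
        (box α⟨ Tset π , Sset π ⟩)
    where
    t s : ℕ
    t = degθ π
    s = degξ π

  pathSeries≈gf : pathSeries n ≈ gf tridegree basisMonomials
  pathSeries≈gf = sums (Π>0 n) ⟫ ≈-sym (gf-concatMap tridegree monomials (Π>0 n))
    where
    sums : ∀ πs → foldr _+_ 0# (map (λ π → u ^ degθ π * v ^ degξ π * stair π) πs) ≈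
                  foldr _+_ 0# (map (gf tridegree ∘ monomials) πs)
    sums []       a b c = refl
    sums (π ∷ πs) = +-cong (monomials≈gf π) (sums πs)

  hasTridegree? : ∀ a b c m → Dec (HasTridegree a b c m)
  hasTridegree? a b c (mono α T S) =
    (Vec.sum α ℕₚ.≟ a) ×-dec (∣ T ∣ ℕₚ.≟ b) ×-dec (∣ S ∣ ℕₚ.≟ c)

  private
    point-hit : ∀ {a b c} m → HasTridegree a b c m → point (tridegree m) a b c ≡ 1
    point-hit (mono α T S) (refl , refl , refl) =
      cong₂ ℕ._*_ (δ-refl (Vec.sum α)) (cong₂ ℕ._*_ (δ-refl ∣ T ∣) (δ-refl ∣ S ∣))

    point-miss : ∀ {a b c} m → ¬ HasTridegree a b c m → point (tridegree m) a b c ≡ 0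
    point-miss {a} {b} {c} (mono α T S) ¬h
      with Vec.sum α ℕₚ.≟ a | ∣ T ∣ ℕₚ.≟ b | ∣ S ∣ ℕₚ.≟ c
    ... | no p | _ | _ rewrite δ-≢ p = refl
    ... | yes _ | no p | _ rewrite δ-≢ p = ℕₚ.*-zeroʳ (δ (Vec.sum α) a)
    ... | yes _ | yes _ | no p rewrite δ-≢ p | ℕₚ.*-zeroʳ (δ ∣ T ∣ b) =
      ℕₚ.*-zeroʳ (δ (Vec.sum α) a)
    ... | yes p | yes q | yes r = contradiction (p , q , r) ¬h

  -- A monomial contributes 1 to the coefficient of its own tridegree and 0 to all others, so a
  -- coefficient counts the entries that the filter keeps.
  length-filter≡gf : ∀ a b c ms →
    length (filter (hasTridegree? a b c) ms) ≡ gf tridegree ms a b c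
  length-filter≡gf a b c [] = refl
  length-filter≡gf a b c (m ∷ ms) = count (hasTridegree? a b c m)
    where
    P? = hasTridegree? a b c
    ih = length-filter≡gf a b c ms
    count : Dec (HasTridegree a b c m) →
      length (filter P? (m ∷ ms)) ≡ gf tridegree (m ∷ ms) a b c
    count (yes h) = ≡.trans (cong length (filter-accept P? {m} {ms} h))
      (cong₂ ℕ._+_ (≡.sym (point-hit {a} {b} {c} m h)) ih)
    count (no ¬h) = ≡.trans (cong length (filter-reject P? {m} {ms} ¬h))
      (cong₂ ℕ._+_ (≡.sym (point-miss {a} {b} {c} m ¬h)) ih)

  ∈-basisMonomials⁺ : ∀ {m} → B⁽¹²⁾ K n m → m ∈ basisMonomials
  ∈-basisMonomials⁺ ((π , π∈Π , refl , refl) , bounded) = ∈-concatMap⁺ monomials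
    (lose (∈-filter⁺ inΠ>0? (∈-stepSequences π) π∈Π) (∈-map⁺ _ (∈-box⁺ α⟨ Tset π , Sset π ⟩ bounded)))

  ∈-basisMonomials⁻ : ∀ {m} → m ∈ basisMonomials → B⁽¹²⁾ K n m
  ∈-basisMonomials⁻ m∈ with find (∈-concatMap⁻ monomials {xs = Π>0 n} m∈)
  ... | π , π∈ , m∈′ with ∈-map⁻ _ m∈′
  ... | α , α∈ , refl =
    (π , proj₂ (∈-filter⁻ inΠ>0? {xs = stepSequences n} π∈) , refl , refl) , ∈-box⁻ α⟨ Tset π , Sset π ⟩ α∈

  -- For one path the exponent vectors differ; for different paths the lists are disjoint, since `T`
  -- and `S` determine the path.
  basisMonomials-unique : Unique basisMonomials
  basisMonomials-unique = concatMap-unique monomials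
    (λ π → Unique.map⁺ (cong Monomial.α) (box-unique α⟨ Tset π , Sset π ⟩))
    same-path
    (Unique.filter⁺ inΠ>0? (stepSequences-unique n))
    where
    decorations : ∀ {m} π → m ∈ monomials π → Vec.zipWith stepWith (Monomial.T m) (Monomial.S m) ≡ π
    decorations π m∈ with ∈-map⁻ _ m∈
    ... | _ , _ , refl = path-decorations π
    same-path : ∀ {π π′ m} → m ∈ monomials π → m ∈ monomials π′ → π ≡ π′
    same-path m∈ m∈′ = ≡.trans (≡.sym (decorations _ m∈)) (decorations _ m∈′)

-- The Hilbert series from the assumed basis

hilbertSeries : ∀ K n →
  Superspace.IsBasis K n U (Superspace.⟦_⟧ K n) (B⁽¹²⁾ K n) → IsHilbertSeries K n (pathSeries n)
hilbertSeries K n basis a b c = ≡.subst (HasDimension (component a b c))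
  -- The dimension first appears as the length of the list of basis monomials of this tridegree,
  -- which is then recognised as a coefficient of the path series.
  (≡.trans (length-filter≡gf a b c basisMonomials) (≡.sym (pathSeries≈gf a b c)))
  (Enumerated.enumerated-dimension coinvariants (filter (hasTridegree? a b c) basisMonomials)
    (Unique.filter⁺ (hasTridegree? a b c) basisMonomials-unique)
    (λ m∈ → let m∈B , h = ∈-filter⁻ (hasTridegree? a b c) {xs = basisMonomials} m∈ in
      ∈-basisMonomials⁻ m∈B , h)
    (λ (m∈B , h) → ∈-filter⁺ (hasTridegree? a b c) (∈-basisMonomials⁺ m∈B) h)
    (component-basis a b c basis))
  where
  open Superspace K n
  open Enumeration K n
  open Tricomponents K n

proposition3p6 : (n : ℕ) → .{{_ : NonZero n}} →
    Superspace.IsBasis ℂ n U (Superspace.⟦_⟧ ℂ n) (B⁽¹²⁾ ℂ n) →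
    IsHilbertSeries ℂ n (pathSeries n)
proposition3p6 n = hilbertSeries ℂ n
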